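{- (i) Suppose that the $\Psi_i$ satisfy (C1) and (C3), and there is some nonzero $\rho\in L$ for which (C2) holds. Then the $\lambda_t$ and the $\Psi_i$ form an $A$-scaffold of tolerance $\mathfrak{T}=1$ on $L$, with shift parameters $b_1,\ldots,b_n$. Moreover $\mathfrak{a}(v_L(\rho))=p^n-1$. (ii) If, furthermore, (C4) holds and $A$ is commutative, then the $\lambda_t$ may be chosen so that the $A$-scaffold has tolerance $\infty$. (iii) Conversely, if the $\lambda_t$ and the $\Psi_i$ form an $A$-scaffold of some tolerance $\mathfrak{T}\geq 1$, then (C1) and (C3) hold, and (C2) holds for any $\rho\in L$ with $\mathfrak{a}(v_L(\rho))=p^n-1$.
   Context: Let $K$ be a local field whose residue field has characteristic $p>0$, let $L/K$ be a totally ramified extension of degree $p^n$, with normalized valuations $v_K,v_L$ ($v_L(L^\times)=\mathbb{Z}$), and let $A$ be a $K$-algebra of dimension $p^n$ acting $K$-linearly on $L$. Let $\mathbb{S}_{p^n}=\{0,\ldots,p^n-1\}$, write $s=\sum_{i=1}^n s_{(n-i)}p^{n-i}$ with digits $s_{(n-i)}\in\{0,\ldots,p-1\}$, and write $s\preceq t$ if $s_{(n-i)}\le t_{(n-i)}$ for all $i$. Let $b_1,\ldots,b_n$ be integers prime to $p$ (shift parameters), let $\mathfrak{b}(s)=\sum_{i=1}^n s_{(n-i)}p^{n-i}b_i$, and let $\mathfrak{a}:\mathbb{Z}\to\mathbb{S}_{p^n}$ be defined by $\mathfrak{a}(t)\in\mathbb{S}_{p^n}$, $\mathfrak{b}(\mathfrak{a}(t))\equiv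 -t \bmod p^n$ (well defined since $s\mapsto \mathfrak{b}(s)\bmod p^n$ is a bijection of $\mathbb{S}_{p^n}$). Let $\Psi_1,\ldots,\Psi_n\in A$, and for $s\in\mathbb{S}_{p^n}$ let $\Upsilon^{(s)}$ be the set of monomials in the (not necessarily commuting) $\Psi_i$ in which the exponents of $\Psi_i$ sum to $s_{(n-i)}$ for each $i$. Consider the conditions: (C1) $\Psi_i\cdot 1=0$ for each $i$; (C2) $v_L(\Psi\cdot\rho)=v_L(\rho)+\mathfrak{b}(s)$ for all $\Psi\in\Upsilon^{(s)}$ and all $s\in\mathbb{S}_{p^n}$, for a given $\rho\in L\setminus\{0\}$; (C3) $v_L(\Psi_i^p\cdot\alpha)>v_L(\alpha)+b_ip^{n-i+1}$ for all $i$ and all $\alpha\in L\setminus\{0\}$; (C4) $\Psi_i^p=0$ for all $i$. Let $\{\lambda_t\}_{t\in\mathbb{Z}}$ be elements of $L$ with $v_L(\lambda_t)=t$ and $\lambda_{t_1}\lambda_{t_2}^{ -1}\in K$ whenever $t_1\equiv t_2\bmod p^n$. An $A$-scaffold on $L$ of tolerance $\mathfrak{T}\ge1$ with shift parameters $b_1,\ldots,b_n$ consists of such $\lambda_t$ together with $\Psi_i\in A$ satisfying $\Psi_i\cdot1=0$ and, for each $i$ and $t$, there is a unit $u_{i,t}\in\mathfrak{O}_K^\times$ with $\Psi_i\cdot\lambda_t\equiv u_{i,t}\lambda_{t+p^{n-i}b_i}$ if $\mathfrak{a}(t)_{(n-i)}\ge1$ and $\Psi_i\cdot\lambda_t\equiv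 0$ if $\mathfrak{a}(t)_{(n-i)}=0$, modulo $\lambda_{t+p^{n-i}b_i}\mathfrak{P}_L^{\mathfrak{T}}$ (with $\mathfrak{P}_L$ the maximal ideal of the valuation ring of $L$); tolerance $\infty$ means these congruences are equalities. -}

module Defs where

open import Algebra.Bundles using (Ring; CommutativeRing)
open import Algebra.Definitions.RawMonoid using (sum)
open import Algebra.Module.Bundles using (LeftModule)
open import Algebra.Module.Structures using (IsLeftModule)
open import Algebra.Morphism.Structures using (IsRingHomomorphism)
import Algebra.Properties.Semiring.Exp as Exp
import Algebra.Properties.Semiring.Mult as Mult
open import Data.Fin.Base using (Fin; zero; suc; toℕ; fromℕ<; finToFun; combine)
open import Data.Fin.Properties using (remQuot-combine; toℕ-fromℕ<) renaming (_≟_ to _≟ᶠ_)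
open import Data.Integer.Base as ℤ using (ℤ; +_; -[1+_])
open import Data.Integer.Coprimality using (Coprime)
open import Data.Integer.Divisibility.Signed using (_∣_; divides)
open import Data.Integer.DivMod using (_%ℕ_; _/ℕ_; n%ℕd<d; a≡a%ℕn+[a/ℕn]*n)
import Data.Integer.Properties as ℤₚ
open import Data.Integer.Tactic.RingSolver using (solve-∀)
open import Data.List.Base using (List; foldr; length; filter)
open import Data.Nat.Base as ℕ using (ℕ; zero; suc; _^_; _∸_; NonZero)
import Data.Nat.Coprimality as ℕCoprime
import Data.Nat.Divisibility.Core as ℕDiv
open import Data.Nat.GCD using (module Bézout)
open import Data.Nat.Primality using (Prime; prime⇒nonZero)
open import Data.Product.Base using (∃; _×_; _,_; proj₁; proj₂)
open import Function.Bundles using (_⇔_; module Equivalence)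
open import Level using (Level; _⊔_) renaming (suc to lsuc)
import Relation.Binary.Construct.Add.Supremum.NonStrict as NonStrict
import Relation.Binary.Construct.Add.Supremum.Strict as Strict
open import Relation.Binary.PropositionalEquality
  using (_≡_; _≢_; refl; sym; trans; cong; module ≡-Reasoning)
open import Relation.Nullary using (¬_; contradiction)
open import Relation.Nullary.Construct.Add.Supremum using (_⁺; [_]; ⊤⁺)

private
  variable
    c₁ ℓ₁ c₂ ℓ₂ c₃ ℓ₃ : Level

------------------------------------------------------------------------
-- ℤ ∪ {∞}, the range of a discrete valuation

open NonStrict ℤ._≤_ public using () renaming (_≤⁺_ to _≤∞_)
open Strict ℤ._<_ public using () renaming (_<⁺_ to _<∞_)

infixl 6 _+∞_

_+∞_ : ℤ ⁺ → ℤ ⁺ → ℤ ⁺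
[ i ] +∞ [ j ] = [ i ℤ.+ j ]
[ _ ] +∞ ⊤⁺    = ⊤⁺
⊤⁺    +∞ _     = ⊤⁺

finitePart : (a : ℤ ⁺) → a ≢ ⊤⁺ → ℤ
finitePart [ i ] _    = i
finitePart ⊤⁺    a≢⊤⁺ = contradiction refl a≢⊤⁺

------------------------------------------------------------------------
-- Fields and normalized discrete valuations

-- The value of _⁻¹ at 0# is unconstrained.
record Field c ℓ : Set (lsuc (c ⊔ ℓ)) where
  infix 8 _⁻¹
  field
    commutativeRing : CommutativeRing c ℓ
  open CommutativeRing commutativeRing public
  field
    _⁻¹        : Carrier → Carrier
    0#≉1#      : ¬ (0# ≈ 1#)
    ⁻¹-inverse : ∀ x → ¬ (x ≈ 0#) → x * x ⁻¹ ≈ 1#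

-- Since ∞ is a value of v and v x ≡ ∞ precisely when x ≈ 0#, equality with
-- 0# is decidable.
record ValuedField c ℓ : Set (lsuc (c ⊔ ℓ)) where
  field
    underlyingField : Field c ℓ
  open Field underlyingField public
  field
    v      : Carrier → ℤ ⁺
    v-cong : ∀ {x y} → x ≈ y → v x ≡ v y
    v-∞    : ∀ x → (v x ≡ ⊤⁺) ⇔ (x ≈ 0#)
    v-*    : ∀ x y → v (x * y) ≡ v x +∞ v y
    -- v (x + y) ≥ min (v x) (v y)
    v-+    : ∀ x y m → m ≤∞ v x → m ≤∞ v y → m ≤∞ v (x + y)
    -- normalization: every integer is the value of some nonzero element
    v-onto : ∀ m → ∃ λ x → v x ≡ [ m ]

  -- the valuation as an integer-valued function on nonzero elements
  ord : ∀ x → ¬ (x ≈ 0#) → ℤ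
  ord x x≉0 = finitePart (v x) λ vx≡∞ → x≉0 (Equivalence.to (v-∞ x) vx≡∞)

  -- the k-th power of the maximal ideal of the valuation ring
  _∈𝔓^_ : Carrier → ℕ → Set
  x ∈𝔓^ k = [ + k ] ≤∞ v x

  IsUnit : Carrier → Set
  IsUnit x = v x ≡ [ + 0 ]

  Complete : Set c
  Complete = ∀ (a : ℕ → Carrier) →
    (∀ m → ∃ λ N → ∀ i j → N ℕ.≤ i → N ℕ.≤ j → [ m ] ≤∞ v (a i - a j)) →
    ∃ λ x → ∀ m → ∃ λ N → ∀ i → N ℕ.≤ i → [ m ] ≤∞ v (a i - x)

  -- The image of m in the residue field vanishes precisely when p ∣ m.
  ResidueCharacteristic : ℕ → Set
  ResidueCharacteristic p = ∀ m → ((m · 1#) ∈𝔓^ 1) ⇔ (p ℕDiv.∣ m)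
    where open Mult semiring using () renaming (_×_ to _·_)

-- Local field in the sense of a complete discretely valued field; the
-- residue field is not required to be finite or perfect.
record LocalField c ℓ (p : ℕ) : Set (lsuc (c ⊔ ℓ)) where
  field
    valuedField : ValuedField c ℓ
  open ValuedField valuedField public
  field
    complete              : Complete
    residueCharacteristic : ResidueCharacteristic p

------------------------------------------------------------------------
-- Dimension, extensions, algebras

HasDimension : {R : Ring c₁ ℓ₁} → LeftModule R c₂ ℓ₂ → ℕ → Set (c₁ ⊔ ℓ₁ ⊔ c₂ ⊔ ℓ₂)
HasDimension {R = R} M d = ∃ λ (e : Fin d → Carrierᴹ) → ∀ x →
  ∃ λ (k : Fin d → R.Carrier) →
    (x ≈ᴹ combination e k) × (∀ k′ → x ≈ᴹ combination e k′ → ∀ i → k i R.≈ k′ i)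
  where
  module R = Ring R
  open LeftModule M
  combination : (Fin d → Carrierᴹ) → (Fin d → R.Carrier) → Carrierᴹ
  combination e k = sum +ᴹ-rawMonoid λ i → k i *ₗ e i

restrictScalars : (R : Ring c₁ ℓ₁) (S : Ring c₂ ℓ₂) {f : Ring.Carrier R → Ring.Carrier S} →
  IsRingHomomorphism (Ring.rawRing R) (Ring.rawRing S) f → LeftModule R c₂ ℓ₂
restrictScalars R S {f} f-homo = record
  { Carrierᴹ = S.Carrier
  ; _≈ᴹ_ = S._≈_
  ; _+ᴹ_ = S._+_
  ; _*ₗ_ = λ r x → f r S.* x
  ; 0ᴹ = S.0#
  ; -ᴹ_ = S.-_
  ; isLeftModule = record
    { isLeftSemimodule = record
      { +ᴹ-isCommutativeMonoid = S.+-isCommutativeMonoid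
      ; isPreleftSemimodule = record
        { *ₗ-cong      = λ r≈s x≈y → S.*-cong (⟦⟧-cong r≈s) x≈y
        ; *ₗ-zeroˡ     = λ x → S.trans (S.*-congʳ 0#-homo) (S.zeroˡ x)
        ; *ₗ-distribʳ  = λ x r s → S.trans (S.*-congʳ (+-homo r s)) (S.distribʳ x (f r) (f s))
        ; *ₗ-identityˡ = λ x → S.trans (S.*-congʳ 1#-homo) (S.*-identityˡ x)
        ; *ₗ-assoc     = λ r s x → S.trans (S.*-congʳ (*-homo r s)) (S.*-assoc (f r) (f s) x)
        ; *ₗ-zeroʳ     = λ r → S.zeroʳ (f r)
        ; *ₗ-distribˡ  = λ r x y → S.distribˡ (f r) x y
        }
      }
    ; -ᴹ‿cong    = S.-‿cong
    ; -ᴹ‿inverse = S.-‿inverse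
    }
  }
  where
  module S = Ring S
  open IsRingHomomorphism f-homo

-- L / K is totally ramified of degree d: its ramification index is [L : K].
record TotallyRamified (K : ValuedField c₁ ℓ₁) (L : ValuedField c₂ ℓ₂) (d : ℕ)
       : Set (c₁ ⊔ ℓ₁ ⊔ c₂ ⊔ ℓ₂) where
  private
    module K = ValuedField K
    module L = ValuedField L
  field
    ι        : K.Carrier → L.Carrier
    ι-homo   : IsRingHomomorphism K.rawRing L.rawRing ι
    degree   : HasDimension (restrictScalars K.ring L.ring ι-homo) d
    ramified : ∀ x m → K.v x ≡ [ m ] → L.v (ι x) ≡ [ + d ℤ.* m ]

-- An associative unital, not necessarily commutative, K-algebra.
record KAlgebra (K : ValuedField c₁ ℓ₁) c₂ ℓ₂ : Set (c₁ ⊔ ℓ₁ ⊔ lsuc (c₂ ⊔ ℓ₂)) where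
  private
    module K = ValuedField K
  field
    ring : Ring c₂ ℓ₂
  open Ring ring public
  field
    η         : K.Carrier → Carrier
    η-homo    : IsRingHomomorphism K.rawRing rawRing η
    η-central : ∀ k x → η k * x ≈ x * η k

  leftModule : LeftModule K.ring c₂ ℓ₂
  leftModule = restrictScalars K.ring ring η-homo

record LinearAction {K : ValuedField c₁ ℓ₁} {L : ValuedField c₂ ℓ₂} {d : ℕ}
       (ext : TotallyRamified K L d) (A : KAlgebra K c₃ ℓ₃)
       : Set (c₁ ⊔ ℓ₁ ⊔ c₂ ⊔ ℓ₂ ⊔ c₃ ⊔ ℓ₃) where
  private
    module L = ValuedField L
    module A = KAlgebra A
  open TotallyRamified ext using (ι)
  infixr 7 _·_
  field
    _·_          : A.Carrier → L.Carrier → L.Carrier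
    isLeftModule : IsLeftModule A.ring L._≈_ L._+_ L.0# L.-_ _·_
    ·-linearʳ    : ∀ a k x → (a · (ι k L.* x)) L.≈ (ι k L.* (a · x))
    ·-linearˡ    : ∀ a k x → ((A.η k A.* a) · x) L.≈ (ι k L.* (a · x))

------------------------------------------------------------------------
-- 𝔟 and 𝔞.  Elements of 𝕊 = {0, …, pⁿ - 1} are elements of Fin (p ^ n), and
-- the indices 1, …, n are shifted to 0, …, n - 1.

-- finToFun lists the base-p digits starting with the most significant one,
-- so its value at the index i ∈ {1, …, n} is the coefficient of p ^ (n - i).
digit : ∀ p {n} → Fin (p ^ n) → Fin n → Fin p
digit p = finToFun

-- place p i = p ^ (n - i) for i ∈ {1, …, n}
place : ∀ p {n} → Fin n → ℕ
place p {n} i = p ^ (n ∸ suc (toℕ i))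

infix 4 _≡_[mod_]

_≡_[mod_] : ℤ → ℤ → ℕ → Set
i ≡ j [mod m ] = + m ∣ (i ℤ.- j)

module _ where
  open import Data.Integer.Base using (_+_; _*_; -_; _-_)

  𝔟 : ∀ p {n} → (Fin n → ℤ) → Fin (p ^ n) → ℤ
  𝔟 p b s = sum ℤ.+-0-rawMonoid λ i → + toℕ (digit p s i) * + place p i * b i

  private
    modInverse : ∀ b p → Coprime b (+ p) → ∃ λ a → a * b ≡ + 1 [mod p ]
    modInverse b p coprime = signed b (absInverse (ℕCoprime.coprime-Bézout coprime))
      where
      lift : ∀ x y z w → 1 ℕ.+ x ℕ.* y ≡ z ℕ.* w → + 1 + + x * + y ≡ + z * + w
      lift x y z w eq = begin
        + 1 + + x * + y     ≡⟨ cong (λ z → + 1 + z) (ℤₚ.pos-* x y) ⟨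
        + (1 ℕ.+ x ℕ.* y)   ≡⟨ cong +_ eq ⟩
        + (z ℕ.* w)         ≡⟨ ℤₚ.pos-* z w ⟩
        + z * + w           ∎
        where open ≡-Reasoning

      absInverse : ∀ {m} → Bézout.Identity 1 m p → ∃ λ a → a * + m ≡ + 1 [mod p ]
      absInverse {m} (Bézout.+- x y eq) =
        + x , divides (+ y) (trans (cong (λ z → z - + 1) (sym (lift y p x m eq))) (ring₁ (+ y * + p)))
        where
        ring₁ : ∀ u → (+ 1 + u) - + 1 ≡ u
        ring₁ = solve-∀
      absInverse {m} (Bézout.-+ x y eq) =
        - + x , divides (- + y)
          (trans (ring₂ (+ x) (+ m)) (trans (cong -_ (lift x m y p eq)) (ℤₚ.neg-distribˡ-* (+ y) (+ p))))
        where
        ring₂ : ∀ u w → - u * w - + 1 ≡ - (+ 1 + u * w)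
        ring₂ = solve-∀

      signed : ∀ i → (∃ λ a → a * + ℤ.∣ i ∣ ≡ + 1 [mod p ]) → ∃ λ a → a * i ≡ + 1 [mod p ]
      signed (+ m)    a           = a
      signed -[1+ m ] (a , divides q eq) = - a , divides q (trans (ring₃ a (+ suc m)) eq)
        where
        ring₃ : ∀ u w → - u * - w - + 1 ≡ u * w - + 1
        ring₃ = solve-∀

    solveDigit : ∀ b p .{{_ : NonZero p}} → Coprime b (+ p) → ∀ q →
                 ∃ λ (d : Fin p) → + p ∣ (+ toℕ d * b + q)
    solveDigit b p coprime q with modInverse b p coprime
    ... | a , divides r eq =
      fromℕ< (n%ℕd<d x p) , divides (- (q * r) - f * b) (begin
        + toℕ (fromℕ< (n%ℕd<d x p)) * b + q
          ≡⟨ cong (λ d → + d * b + q) (toℕ-fromℕ< (n%ℕd<d x p)) ⟩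
        + (x %ℕ p) * b + q
          ≡⟨ ring₁ (+ (x %ℕ p)) f (+ p) b q ⟩
        (+ (x %ℕ p) + f * + p) * b + q - f * + p * b
          ≡⟨ cong (λ z → z * b + q - f * + p * b) (a≡a%ℕn+[a/ℕn]*n x p) ⟨
        x * b + q - f * + p * b
          ≡⟨ ring₂ q a b (f * + p * b) ⟩
        - q * (a * b - + 1) - f * + p * b
          ≡⟨ cong (λ z → - q * z - f * + p * b) eq ⟩
        - q * (r * + p) - f * + p * b
          ≡⟨ ring₃ q r (+ p) f b ⟩
        (- (q * r) - f * b) * + p ∎)
      where
      open ≡-Reasoning
      x = - (q * a)
      f = x /ℕ p
      ring₁ : ∀ m f p b q → m * b + q ≡ (m + f * p) * b + q - f * p * b
      ring₁ = solve-∀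
      ring₂ : ∀ q a b t → - (q * a) * b + q - t ≡ - q * (a * b - + 1) - t
      ring₂ = solve-∀
      ring₃ : ∀ q r p f b → - q * (r * p) - f * p * b ≡ (- (q * r) - f * b) * p
      ring₃ = solve-∀

    𝔟-combine : ∀ p {n} (b : Fin (suc n) → ℤ) d s →
                𝔟 p b (combine d s) ≡
                + toℕ d * + (p ^ n) * b zero + 𝔟 p (λ i → b (suc i)) s
    𝔟-combine p {n} b d s = cong leading (remQuot-combine {p} {p ^ n} d s)
      where
      leading : Fin p × Fin (p ^ n) → ℤ
      leading (d , s) = + toℕ d * + (p ^ n) * b zero + 𝔟 p (λ i → b (suc i)) s

    extend : ∀ d P b x t q e p → x - t ≡ q * P → d * b + q ≡ e * p →
             d * P * b + x - t ≡ e * (p * P)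
    extend d P b x t q e p eq eq′ = begin
      d * P * b + x - t     ≡⟨ ring₁ d P b x t ⟩
      d * b * P + (x - t)   ≡⟨ cong (λ z → d * b * P + z) eq ⟩
      d * b * P + q * P     ≡⟨ ℤₚ.*-distribʳ-+ P (d * b) q ⟨
      (d * b + q) * P       ≡⟨ cong (λ z → z * P) eq′ ⟩
      e * p * P             ≡⟨ ℤₚ.*-assoc e p P ⟩
      e * (p * P)           ∎
      where
      open ≡-Reasoning
      ring₁ : ∀ d P b x t → d * P * b + x - t ≡ d * b * P + (x - t)
      ring₁ = solve-∀

  abstract
    𝔟-onto : ∀ p {n} .{{_ : NonZero p}} (b : Fin n → ℤ) → (∀ i → Coprime (b i) (+ p)) →
             ∀ t → ∃ λ s → 𝔟 p b s ≡ - t [mod p ^ n ]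
    𝔟-onto p {zero}  b coprime t = zero , divides (𝔟 p b zero - - t) (sym (ℤₚ.*-identityʳ _))
    𝔟-onto p {suc n} b coprime t = step (𝔟-onto p b′ (λ i → coprime (suc i)) t)
      where
      b′ : Fin n → ℤ
      b′ i = b (suc i)
      step : (∃ λ s → 𝔟 p b′ s ≡ - t [mod p ^ n ]) → ∃ λ s → 𝔟 p b s ≡ - t [mod p ^ suc n ]
      step (s , divides q eq) = prepend (solveDigit (b zero) p (coprime zero) q)
        where
        prepend : (∃ λ (d : Fin p) → + p ∣ (+ toℕ d * b zero + q)) →
                  ∃ λ s → 𝔟 p b s ≡ - t [mod p ^ suc n ]
        prepend (d , divides e eq′) = combine d s , divides e (begin
          𝔟 p b (combine d s) - - t
            ≡⟨ cong (λ z → z - - t) (𝔟-combine p b d s) ⟩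
          + toℕ d * + (p ^ n) * b zero + 𝔟 p b′ s - - t
            ≡⟨ extend (+ toℕ d) (+ (p ^ n)) (b zero) (𝔟 p b′ s) (- t) q e (+ p) eq eq′ ⟩
          e * (+ p * + (p ^ n))
            ≡⟨ cong (λ z → e * z) (ℤₚ.pos-* p (p ^ n)) ⟨
          e * + (p ^ suc n) ∎)
          where open ≡-Reasoning

  -- 𝔟 is a bijection modulo p ^ n, so its defining congruence determines
  -- 𝔞 t uniquely.
  𝔞 : ∀ p {n} → Prime p → (b : Fin n → ℤ) → (∀ i → Coprime (b i) (+ p)) → ℤ → Fin (p ^ n)
  𝔞 p p-prime b coprime t = proj₁ (𝔟-onto p {{prime⇒nonZero p-prime}} b coprime t)

  𝔞-spec : ∀ p {n} (p-prime : Prime p) (b : Fin n → ℤ) (coprime : ∀ i → Coprime (b i) (+ p)) t →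
           𝔟 p b (𝔞 p p-prime b coprime t) ≡ - t [mod p ^ n ]
  𝔞-spec p p-prime b coprime t = proj₂ (𝔟-onto p {{prime⇒nonZero p-prime}} b coprime t)

------------------------------------------------------------------------
-- Scaffolds

module Scaffolds
  (p n : ℕ) (p-prime : Prime p)
  {K : ValuedField c₁ ℓ₁} {L : ValuedField c₂ ℓ₂} (ext : TotallyRamified K L (p ^ n))
  (A : KAlgebra K c₃ ℓ₃) (action : LinearAction ext A)
  (b : Fin n → ℤ) (b-coprime : ∀ i → Coprime (b i) (+ p))
  where

  private
    module K = ValuedField K
    module L = ValuedField L
    module A = KAlgebra A
  open TotallyRamified ext using (ι)
  open LinearAction action using (_·_)
  open Exp A.semiring using () renaming (_^_ to _^ᴬ_)
  open NonStrict ℕ._≤_ using () renaming (_≤⁺_ to _≤ᵀ_)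

  𝔞ᵇ : ℤ → Fin (p ^ n)
  𝔞ᵇ = 𝔞 p p-prime b b-coprime

  monomial : (Fin n → A.Carrier) → List (Fin n) → A.Carrier
  monomial Ψ = foldr (λ i x → Ψ i A.* x) A.1#

  occurrences : Fin n → List (Fin n) → ℕ
  occurrences i w = length (filter (i ≟ᶠ_) w)

  Υ : (Fin n → A.Carrier) → Fin (p ^ n) → A.Carrier → Set ℓ₃
  Υ Ψ s x = ∃ λ w → (∀ i → occurrences i w ≡ toℕ (digit p s i)) × x A.≈ monomial Ψ w

  C1 : (Fin n → A.Carrier) → Set ℓ₂
  C1 Ψ = ∀ i → (Ψ i · L.1#) L.≈ L.0#

  C2 : (Fin n → A.Carrier) → L.Carrier → Set (c₃ ⊔ ℓ₃)
  C2 Ψ ρ = ∀ s x → Υ Ψ s x → L.v (x · ρ) ≡ L.v ρ +∞ [ 𝔟 p b s ]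

  -- With i shifted by one, the exponent n - i + 1 becomes n ∸ toℕ i.
  C3 : (Fin n → A.Carrier) → Set (c₂ ⊔ ℓ₂)
  C3 Ψ = ∀ i α → ¬ (α L.≈ L.0#) →
    L.v α +∞ [ b i ℤ.* + (p ^ (n ∸ toℕ i)) ] <∞ L.v ((Ψ i ^ᴬ p) · α)

  C4 : (Fin n → A.Carrier) → Set ℓ₃
  C4 Ψ = ∀ i → (Ψ i ^ᴬ p) A.≈ A.0#

  record IsFamily (lam : ℤ → L.Carrier) : Set (c₁ ⊔ ℓ₂) where
    field
      v-lam     : ∀ t → L.v (lam t) ≡ [ t ]
      lam-ratio : ∀ t₁ t₂ → t₁ ≡ t₂ [mod p ^ n ] →
                  ∃ λ k → (lam t₁ L.* lam t₂ L.⁻¹) L.≈ ι k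

  -- x ≈ y [mod l 𝔓^ 𝔗 ] is congruence modulo l times the 𝔗-th power of the
  -- maximal ideal of the valuation ring of L, and equality when 𝔗 is ∞.
  data _≈_[mod_𝔓^_] (x y l : L.Carrier) : ℕ ⁺ → Set (c₂ ⊔ ℓ₂) where
    congruent : ∀ {T} z → z L.∈𝔓^ T → (x L.- y) L.≈ (l L.* z) → x ≈ y [mod l 𝔓^ [ T ] ]
    equal     : x L.≈ y → x ≈ y [mod l 𝔓^ ⊤⁺ ]

  -- Tolerances are elements of ℕ ∪ {∞}.
  record IsScaffold (lam : ℤ → L.Carrier) (Ψ : Fin n → A.Carrier) (𝔗 : ℕ ⁺)
         : Set (c₁ ⊔ c₂ ⊔ ℓ₂) where
    shift : ℤ → Fin n → ℤ
    shift t i = t ℤ.+ + place p i ℤ.* b i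
    field
      1≤𝔗      : [ 1 ] ≤ᵀ 𝔗
      isFamily : IsFamily lam
      Ψ·1≈0    : ∀ i → (Ψ i · L.1#) L.≈ L.0#
      Ψ·lam-≥1 : ∀ i t → 1 ℕ.≤ toℕ (digit p (𝔞ᵇ t) i) →
                 ∃ λ u → K.IsUnit u ×
                   ((Ψ i · lam t) ≈ (ι u L.* lam (shift t i)) [mod lam (shift t i) 𝔓^ 𝔗 ])
      Ψ·lam-≡0 : ∀ i t → toℕ (digit p (𝔞ᵇ t) i) ≡ 0 →
                 (Ψ i · lam t) ≈ L.0# [mod lam (shift t i) 𝔓^ 𝔗 ]

{-# OPTIONS --safe #-}

-- Since L / K is totally ramified of degree pⁿ, pⁿ elements of L whose valuations are distinct
-- modulo pⁿ form a K-basis, and v of a linear combination is the minimum of v over its terms,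
-- attained at exactly one of them.  So a bound v (Ψᵢ · e) ≥ v e + pⁿ⁻ⁱ bᵢ on such a basis extends
-- to L, and whether it is attained at α depends only on the leading term of α, that is, on
-- v α modulo pⁿ.
--
-- Given ρ, the elements Ψ^(s) · ρ form such a basis by (C2).  With the factors Ψᵢ of the monomial
-- Ψ^(s) on the left, the bound is attained when the i-th digit of s is less than p - 1, by (C2),
-- and strict when it is p - 1, by (C3).  An element of valuation ≡ 0 is congruent to an element of
-- K, which Ψᵢ kills by (C1), so the bound is strict there; hence 𝔞(v ρ) = pⁿ - 1, and the i-th
-- digits of s and of 𝔞(v (Ψ^(s) · ρ)) add up to p - 1.  For (ii), take the λ_t to be multiples of the
-- Ψ^(s) · ρ by elements of K.
--
-- Conversely, a scaffold decides on the basis of the λ_t when the bound is attained, and each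
-- time Ψᵢ attains it the i-th digit of 𝔞(v α) drops by one.
module Submission where

open import Defs
open import Algebra.Bundles using (Semiring)
open import Algebra.Definitions using (Commutative)
open import Algebra.Module.Structures using (IsLeftModule)
open import Algebra.Morphism.Structures using (IsRingHomomorphism)
import Algebra.Properties.AbelianGroup as AbelianGroupProperties
import Algebra.Properties.CommutativeSemigroup as CommutativeSemigroupProperties
import Algebra.Properties.Ring as RingProperties
import Algebra.Properties.Semiring.Exp as Exp
import Algebra.Properties.Semiring.Sum as SemiringSum
open import Data.Fin.Base
  using (Fin; zero; suc; toℕ; fromℕ<; punchIn; funToFin; combine; quotient; remainder)
open import Data.Fin.Properties
  using (_≟_; any?; punchInᵢ≢i; nonZeroIndex; toℕ<n; toℕ-fromℕ<; toℕ-injective;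
         combine-remQuot; toℕ-combine; finToFun-funToFin; suc-injective)
open import Data.Integer.Base as ℤ using (ℤ; +_; ∣_∣)
open import Data.Integer.Coprimality using (Coprime; coprime-divisor)
import Data.Integer.Coprimality as ℤCoprime
open import Data.Integer.Divisibility.Signed
  using (_∣_; divides; ∣-trans; ∣m+n∣m⇒∣n; ∣m⇒∣m*n; ∣n⇒∣m*n; ∣⇒∣ᵤ; *-cancelʳ-∣; ∣-refl)
import Data.Integer.Properties as ℤₚ
open import Data.Integer.Tactic.RingSolver using (solve-∀)
open import Data.List.Base using (List; []; _∷_; _++_; length; filter; replicate; map)
open import Data.List.Properties using (filter-accept; filter-reject)
open import Data.Nat.Base as ℕ using (ℕ; zero; suc; _^_; _∸_; NonZero)
import Data.Nat.Divisibility as ℕDiv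
open import Data.Nat.Primality using (Prime; prime⇒nonZero)
import Data.Nat.Properties as ℕₚ
open import Data.Product.Base using (∃; _×_; _,_; proj₁; proj₂)
open import Data.Sum.Base using (_⊎_; inj₁; inj₂)
open import Data.Vec.Functional using (insertAt; removeAt; updateAt)
open import Data.Vec.Functional.Properties
  using (insertAt-lookup; insertAt-punchIn; updateAt-updates; updateAt-minimal)
open import Function.Base using (_∘_; const)
open import Function.Bundles using (module Equivalence)
open import Level using (Level; _⊔_)
import Relation.Binary.Construct.Add.Supremum.NonStrict as NonStrict
import Relation.Binary.Construct.Add.Supremum.Strict as Strict
open import Relation.Binary.Definitions using (tri<; tri≈; tri>)
open import Relation.Binary.PropositionalEquality as ≡
  using (_≡_; _≢_; refl; cong; cong₂; subst)
import Relation.Binary.Reasoning.Setoid as SetoidReasoning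
open import Relation.Nullary using (¬_; contradiction; Dec; yes; no)
open import Relation.Nullary.Construct.Add.Supremum using (_⁺; [_]; ⊤⁺; []-injective)
open import Relation.Nullary.Decidable using (¬?; decidable-stable)

open NonStrict ℤ._≤_ using ([_]; _≤⊤⁺; ≤⁺-trans; [≤]-injective)
open NonStrict ℕ._≤_ using () renaming (_≤⁺_ to _≤ᵀ_; [_] to [_]ᵀ; _≤⊤⁺ to _≤⊤ᵀ)
open Strict ℤ._<_ using ([_]; [_]<⊤⁺)

private
  variable
    c₁ ℓ₁ c₂ ℓ₂ c₃ ℓ₃ : Level

  module ℤGroup = AbelianGroupProperties ℤₚ.+-0-abelianGroup
  module ℕ+ = CommutativeSemigroupProperties ℕₚ.+-commutativeSemigroup

-- Finite sums and minima in ℤ ∪ {∞}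

module FiniteSum (R : Semiring c₁ ℓ₁) where
  open Semiring R hiding (refl; zero)
  open SemiringSum R

  sum-zero : ∀ {k} (x : Fin k → Carrier) → (∀ i → x i ≈ 0#) → sum x ≈ 0#
  sum-zero {k} x x≈0 = trans (sum-cong-≋ x≈0) (sum-replicate-zero k)

  sum-single : ∀ {k} (x : Fin k → Carrier) i → (∀ j → j ≢ i → x j ≈ 0#) → sum x ≈ x i
  sum-single {suc k} x i x≈0 = trans (sum-remove {i = i} x)
    (trans (+-congˡ (sum-zero (removeAt x i) λ j → x≈0 (punchIn i j) (punchInᵢ≢i i j))) (+-identityʳ (x i)))

private
  module ℤSum where
    open SemiringSum ℤₚ.+-*-semiring public
    open FiniteSum ℤₚ.+-*-semiring public

1+assoc : ∀ t δ → + 1 ℤ.+ (t ℤ.+ δ) ≡ + 1 ℤ.+ t ℤ.+ δ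
1+assoc = solve-∀

i+i≡i⇒i≡0 : ∀ {i} → i ℤ.+ i ≡ i → i ≡ + 0
i+i≡i⇒i≡0 {i} eq = ℤGroup.identityˡ-unique i i eq

i+i≡0⇒i≡0 : ∀ i → i ℤ.+ i ≡ + 0 → i ≡ + 0
i+i≡0⇒i≡0 (+ zero) _ = refl

<∞⇒1+≤∞ : ∀ {i a} → [ i ] <∞ a → [ + 1 ℤ.+ i ] ≤∞ a
<∞⇒1+≤∞ [ i<j ]     = [ ℤₚ.i<j⇒suc[i]≤j i<j ]
<∞⇒1+≤∞ ([ _ ]<⊤⁺) = _ ≤⊤⁺

1+≤∞⇒<∞ : ∀ {i a} → [ + 1 ℤ.+ i ] ≤∞ a → [ i ] <∞ a
1+≤∞⇒<∞ [ 1+i≤j ]  = [ ℤₚ.suc[i]≤j⇒i<j 1+i≤j ]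
1+≤∞⇒<∞ (_ ≤⊤⁺)   = [ _ ]<⊤⁺

+∞-mono : ∀ {i j a b} → [ i ] ≤∞ a → [ j ] ≤∞ b → [ i ℤ.+ j ] ≤∞ (a +∞ b)
+∞-mono [ p ]    [ q ]    = [ ℤₚ.+-mono-≤ p q ]
+∞-mono [ _ ]    (_ ≤⊤⁺) = _ ≤⊤⁺
+∞-mono (_ ≤⊤⁺) _        = _ ≤⊤⁺

-- Distinctness is asked of finite values only, because several terms of a combination may vanish.
-- The gap of a full unit above the minimum is what later makes the ultrametric inequality an
-- equality.
uniqueMinimum : ∀ {k} (a : Fin k → ℤ ⁺) → (∀ i j t → a i ≡ [ t ] → a j ≡ [ t ] → i ≡ j) →
          (∀ i → a i ≡ ⊤⁺) ⊎
          ∃ λ i → ∃ λ t → a i ≡ [ t ] × (∀ j → j ≢ i → [ + 1 ℤ.+ t ] ≤∞ a j)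
uniqueMinimum {zero}  a distinct = inj₁ λ ()
uniqueMinimum {suc k} a distinct
  with a zero in eq | uniqueMinimum (a ∘ suc) (λ i j t p q → suc-injective (distinct (suc i) (suc j) t p q))
... | ⊤⁺ | inj₁ all⊤ = inj₁ λ { zero → eq ; (suc i) → all⊤ i }
... | [ s ] | inj₁ all⊤ = inj₂ (zero , s , eq ,
  λ { zero 0≢0 → contradiction refl 0≢0
    ; (suc j) _ → subst ([ + 1 ℤ.+ s ] ≤∞_) (≡.sym (all⊤ j)) (_ ≤⊤⁺) })
... | ⊤⁺ | inj₂ (i , t , aᵢ≡t , others) = inj₂ (suc i , t , aᵢ≡t ,
  λ { zero _ → subst ([ + 1 ℤ.+ t ] ≤∞_) (≡.sym eq) (_ ≤⊤⁺)
    ; (suc j) j≢i → others j (j≢i ∘ cong suc) })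
... | [ s ] | inj₂ (i , t , aᵢ≡t , others) with ℤₚ.<-cmp s t
... | tri≈ _ refl _ = contradiction (distinct zero (suc i) s eq aᵢ≡t) λ ()
... | tri> _ _ t<s = inj₂ (suc i , t , aᵢ≡t ,
  λ { zero _ → subst ([ + 1 ℤ.+ t ] ≤∞_) (≡.sym eq) [ ℤₚ.i<j⇒suc[i]≤j t<s ]
    ; (suc j) j≢i → others j (j≢i ∘ cong suc) })
... | tri< s<t _ _ = inj₂ (zero , s , eq , above)
  where
  above : ∀ j → j ≢ zero → [ + 1 ℤ.+ s ] ≤∞ a j
  above zero    0≢0 = contradiction refl 0≢0
  above (suc j) _ with j ≟ i
  ... | yes refl = subst ([ + 1 ℤ.+ s ] ≤∞_) (≡.sym aᵢ≡t) [ ℤₚ.i<j⇒suc[i]≤j s<t ]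
  ... | no j≢i = ≤⁺-trans ℤₚ.≤-trans [ ℤₚ.+-monoʳ-≤ (+ 1) (ℤₚ.<⇒≤ s<t) ] (others j j≢i)

-- Linear relations over a field

module LinearAlgebra (F : Field c₁ ℓ₁) (_≈0? : ∀ x → Dec (Field._≈_ F x (Field.0# F))) where
  open Field F hiding (refl; zero)
  open RingProperties ring using (-‿distribˡ-*; -‿distribʳ-*)
  open SemiringSum semiring using (sum; sum-cong-≋; sum-remove; ∑-distrib-+; *-distribʳ-sum)
  open FiniteSum semiring using (sum-zero)
  open SetoidReasoning setoid

  -- Gaussian elimination, by induction on the number of columns. If the first column vanishes, row
  -- `zero` gets coefficient 0 and the remaining rows are related by induction. Otherwise a row r
  -- with nonzero first entry clears that column in the other rows, and a relation between the
  -- reduced rows is lifted back.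
  linearRelation : ∀ m (A : Fin (suc m) → Fin m → Carrier) →
    ∃ λ (k : Fin (suc m) → Carrier) →
      (∃ λ i → ¬ (k i ≈ 0#)) × (∀ j → sum (λ i → k i * A i j) ≈ 0#)
  linearRelation zero A = (λ _ → 1#) , (zero , 0#≉1# ∘ sym) , λ ()
  linearRelation (suc m) A with any? (λ i → ¬? (A i zero ≈0?))
  ... | no none = k , (suc i , kᵢ≉0) , relation
    where
    IH = linearRelation m (λ i j → A (suc i) (suc j))
    i = proj₁ (proj₁ (proj₂ IH))
    kᵢ≉0 = proj₂ (proj₁ (proj₂ IH))
    k : Fin (suc (suc m)) → Carrier
    k zero    = 0#
    k (suc i) = proj₁ IH i
    relation : ∀ j → sum (λ i → k i * A i j) ≈ 0#
    relation zero = sum-zero _ λ i →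
      trans (*-congˡ (decidable-stable (A i zero ≈0?) λ A≉0 → none (i , A≉0))) (zeroʳ (k i))
    relation (suc j) = trans (+-cong (zeroˡ _) (proj₂ (proj₂ IH) j)) (+-identityˡ 0#)
  ... | yes (r , pivot≉0) =
    k , (punchIn r i , kᵢ≉0 ∘ trans (reflexive (≡.sym (insertAt-punchIn k′ r _ i)))) , relation
    where
    q : Fin (suc m) → Carrier
    q i = A (punchIn r i) zero * A r zero ⁻¹
    reduced : Fin (suc m) → Fin (suc m) → Carrier
    reduced i j = A (punchIn r i) j - q i * A r j
    IH = linearRelation m (λ i j → reduced i (suc j))
    k′ = proj₁ IH
    i = proj₁ (proj₁ (proj₂ IH))
    kᵢ≉0 = proj₂ (proj₁ (proj₂ IH))
    k : Fin (suc (suc m)) → Carrier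
    -- The pivot row compensates for the multiples `q i` of it that were subtracted from the other
    -- rows.
    k = insertAt k′ r (- sum (λ i → k′ i * q i))

    eliminate : ∀ x y a z → z * (x - y * a) ≈ z * x + z * y * - a
    eliminate x y a z = begin
      z * (x - y * a)           ≈⟨ distribˡ z x (- (y * a)) ⟩
      z * x + z * - (y * a)     ≈⟨ +-congˡ (*-congˡ (-‿distribʳ-* y a)) ⟩
      z * x + z * (y * - a)     ≈⟨ +-congˡ (*-assoc z y (- a)) ⟨
      z * x + z * y * - a       ∎

    reduce : ∀ j → sum (λ i → k i * A i j) ≈ sum (λ i → k′ i * reduced i j)
    reduce j = begin
      sum (λ i → k i * A i j)
        ≈⟨ sum-remove {i = r} (λ i → k i * A i j) ⟩
      k r * A r j + sum (λ i → k (punchIn r i) * A (punchIn r i) j)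
        ≈⟨ +-cong (*-congʳ (reflexive (insertAt-lookup k′ r (- s))))
                  (sum-cong-≋ λ i → *-congʳ {A (punchIn r i) j} (reflexive (insertAt-punchIn k′ r (- s) i))) ⟩
      - s * A r j + sum (λ i → k′ i * A (punchIn r i) j)
        ≈⟨ +-comm _ _ ⟩
      sum (λ i → k′ i * A (punchIn r i) j) + - s * A r j
        ≈⟨ +-congˡ (trans (sym (-‿distribˡ-* s (A r j))) (-‿distribʳ-* s (A r j))) ⟩
      sum (λ i → k′ i * A (punchIn r i) j) + s * - A r j
        ≈⟨ +-congˡ (*-distribʳ-sum (- A r j) (λ i → k′ i * q i)) ⟩
      sum (λ i → k′ i * A (punchIn r i) j) + sum (λ i → k′ i * q i * - A r j)
        ≈⟨ ∑-distrib-+ (λ i → k′ i * A (punchIn r i) j) (λ i → k′ i * q i * - A r j) ⟨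
      sum (λ i → k′ i * A (punchIn r i) j + k′ i * q i * - A r j)
        ≈⟨ sum-cong-≋ (λ i → eliminate (A (punchIn r i) j) (q i) (A r j) (k′ i)) ⟨
      sum (λ i → k′ i * reduced i j) ∎
      where s = sum (λ i → k′ i * q i)

    reduced-zero : ∀ i → reduced i zero ≈ 0#
    reduced-zero i = begin
      a - a * pivot ⁻¹ * pivot      ≈⟨ +-congˡ (-‿cong (*-assoc a (pivot ⁻¹) pivot)) ⟩
      a - a * (pivot ⁻¹ * pivot)    ≈⟨ +-congˡ (-‿cong (*-congˡ
                                         (trans (*-comm _ _) (⁻¹-inverse pivot pivot≉0)))) ⟩
      a - a * 1#                    ≈⟨ +-congˡ (-‿cong (*-identityʳ a)) ⟩
      a - a                         ≈⟨ -‿inverseʳ a ⟩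
      0#                            ∎
      where
      a = A (punchIn r i) zero
      pivot = A r zero

    relation : ∀ j → sum (λ i → k i * A i j) ≈ 0#
    relation zero    = trans (reduce zero)
      (sum-zero _ λ i → trans (*-congˡ {k′ i} (reduced-zero i)) (zeroʳ (k′ i)))
    relation (suc j) = trans (reduce (suc j)) (proj₂ (proj₂ IH) j)

-- Values and lower bounds in a valued field

module Valuation (F : ValuedField c₁ ℓ₁) where
  open ValuedField F hiding (refl; zero)
  open SemiringSum semiring using (sum; sum-remove)
  open RingProperties ring using (-‿involutive; -1*x≈-x)

  infix 4 _≽_

  -- A lower bound makes sense at zero too, so sums and products need no case distinction. As values
  -- are integers, strict bounds are written `x ≽ + 1 ℤ.+ m`.
  _≽_ : Carrier → ℤ → Set
  x ≽ m = [ m ] ≤∞ v x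

  _≈0? : ∀ x → Dec (x ≈ 0#)
  x ≈0? with v x in eq
  ... | ⊤⁺    = yes (Equivalence.to (v-∞ x) eq)
  ... | [ m ] = no λ x≈0 → contradiction (≡.trans (≡.sym eq) (Equivalence.from (v-∞ x) x≈0)) λ ()

  v-0 : v 0# ≡ ⊤⁺
  v-0 = Equivalence.from (v-∞ 0#) (ValuedField.refl F)

  v-ord : ∀ x (x≉0 : ¬ (x ≈ 0#)) → v x ≡ [ ord x x≉0 ]
  v-ord x x≉0 = finite (v x) _
    where
    finite : ∀ a (a≢⊤ : a ≢ ⊤⁺) → a ≡ [ finitePart a a≢⊤ ]
    finite [ _ ] _   = refl
    finite ⊤⁺    a≢⊤ = contradiction refl a≢⊤

  v≡[]⇒≉0 : ∀ {x m} → v x ≡ [ m ] → ¬ (x ≈ 0#)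
  v≡[]⇒≉0 {x} vx≡m x≈0 = contradiction (≡.trans (≡.sym vx≡m) (≡.trans (v-cong x≈0) v-0)) λ ()

  v-1 : v 1# ≡ [ + 0 ]
  v-1 = idempotent (v-ord 1# (0#≉1# ∘ sym)) (≡.trans (v-cong (sym (*-identityˡ 1#))) (v-* 1# 1#))
    where
    idempotent : ∀ {a i} → a ≡ [ i ] → a ≡ a +∞ a → a ≡ [ + 0 ]
    idempotent refl eq = cong [_] (i+i≡i⇒i≡0 ([]-injective (≡.sym eq)))

  -- The square of `- 1#` is `1#`, so twice the value of `- 1#` is 0.
  v-neg : ∀ x → v (- x) ≡ v x
  v-neg x = ≡.trans (v-cong (sym (-1*x≈-x x))) (≡.trans (v-* (- 1#) x)
    (≡.trans (cong (_+∞ v x) (halve (v (- 1#)) square)) (0+∞ (v x))))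
    where
    square : v (- 1#) +∞ v (- 1#) ≡ [ + 0 ]
    square = ≡.trans (≡.sym (v-* (- 1#) (- 1#)))
      (≡.trans (v-cong (trans (-1*x≈-x (- 1#)) (-‿involutive 1#))) v-1)
    halve : ∀ a → a +∞ a ≡ [ + 0 ] → a ≡ [ + 0 ]
    halve [ i ] eq = cong [_] (i+i≡0⇒i≡0 i ([]-injective eq))
    0+∞ : ∀ a → [ + 0 ] +∞ a ≡ a
    0+∞ [ i ] = cong [_] (ℤₚ.+-identityˡ i)
    0+∞ ⊤⁺    = refl

  v-*-[] : ∀ {x y i j} → v x ≡ [ i ] → v y ≡ [ j ] → v (x * y) ≡ [ i ℤ.+ j ]
  v-*-[] {x} {y} vx≡i vy≡j = ≡.trans (v-* x y) (cong₂ _+∞_ vx≡i vy≡j)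

  v-⁻¹ : ∀ {x m} → v x ≡ [ m ] → v (x ⁻¹) ≡ [ ℤ.- m ]
  v-⁻¹ {x} {m} vx≡m = solve (v (x ⁻¹))
    (≡.trans (cong (_+∞ v (x ⁻¹)) (≡.sym vx≡m)) (≡.trans (≡.sym (v-* x (x ⁻¹)))
    (≡.trans (v-cong (⁻¹-inverse x (v≡[]⇒≉0 vx≡m))) v-1)))
    where
    ring₁ : ∀ m i → i ≡ (m ℤ.+ i) ℤ.- m
    ring₁ = solve-∀
    solve : ∀ a → [ m ] +∞ a ≡ [ + 0 ] → a ≡ [ ℤ.- m ]
    solve [ i ] eq = cong [_] (≡.trans (ring₁ m i)
      (≡.trans (cong (ℤ._- m) ([]-injective eq)) (ℤₚ.+-identityˡ (ℤ.- m))))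

  ≽-cong : ∀ {x y m} → x ≈ y → x ≽ m → y ≽ m
  ≽-cong {m = m} x≈y = subst ([ m ] ≤∞_) (v-cong x≈y)

  ≽-weaken : ∀ {x i j} → i ℤ.≤ j → x ≽ j → x ≽ i
  ≽-weaken i≤j = ≤⁺-trans ℤₚ.≤-trans [ i≤j ]

  ≽-0 : ∀ {x m} → x ≈ 0# → x ≽ m
  ≽-0 {x} {m} x≈0 = subst ([ m ] ≤∞_) (≡.sym (Equivalence.from (v-∞ x) x≈0)) (_ ≤⊤⁺)

  v≡[]⇒≽ : ∀ {x m} → v x ≡ [ m ] → x ≽ m
  v≡[]⇒≽ {m = m} vx≡m = subst ([ m ] ≤∞_) (≡.sym vx≡m) [ ℤₚ.≤-refl ]

  ≽-+ : ∀ {x y m} → x ≽ m → y ≽ m → x + y ≽ m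
  ≽-+ {x} {y} {m} = v-+ x y [ m ]

  ≽-neg : ∀ {x m} → x ≽ m → - x ≽ m
  ≽-neg {x} {m} = subst ([ m ] ≤∞_) (≡.sym (v-neg x))

  ≽-* : ∀ {x y i j} → x ≽ i → y ≽ j → x * y ≽ i ℤ.+ j
  ≽-* {x} {y} {i} {j} x≽i y≽j = subst ([ i ℤ.+ j ] ≤∞_) (≡.sym (v-* x y)) (+∞-mono x≽i y≽j)

  ≽-sum : ∀ {k m} (x : Fin k → Carrier) → (∀ i → x i ≽ m) → sum x ≽ m
  ≽-sum {zero}  x x≽m = ≽-0 (ValuedField.refl F)
  ≽-sum {suc k} x x≽m = ≽-+ (x≽m zero) (≽-sum (x ∘ suc) (x≽m ∘ suc))

  ≽-split : ∀ {x m} → x ≽ m → v x ≡ [ m ] ⊎ x ≽ + 1 ℤ.+ m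
  ≽-split {x} {m} x≽m = split x≽m
    where
    split : ∀ {a} → [ m ] ≤∞ a → a ≡ [ m ] ⊎ [ + 1 ℤ.+ m ] ≤∞ a
    split (_ ≤⊤⁺) = inj₂ (_ ≤⊤⁺)
    split ([_] {l = j} m≤j) with m ℤₚ.≟ j
    ... | yes refl = inj₁ refl
    ... | no  m≢j  = inj₂ [ ℤₚ.i<j⇒suc[i]≤j (ℤₚ.≤∧≢⇒< m≤j m≢j) ]

  v≡[]⇒⋡ : ∀ {x m} → v x ≡ [ m ] → ¬ (x ≽ + 1 ℤ.+ m)
  v≡[]⇒⋡ {x} {m} vx≡m x≽1+m = irrefl (subst ([ + 1 ℤ.+ m ] ≤∞_) vx≡m x≽1+m)
    where
    irrefl : ¬ ([ + 1 ℤ.+ m ] ≤∞ [ m ])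
    irrefl [ 1+m≤m ] = ℤₚ.<-irrefl refl (ℤₚ.suc[i]≤j⇒i<j 1+m≤m)

  -- If x + y had a larger value than m, then so would x = (x + y) - y.
  v-perturb : ∀ {x y m} → v x ≡ [ m ] → y ≽ + 1 ℤ.+ m → v (x + y) ≡ [ m ]
  v-perturb {x} {y} {m} vx≡m y≽1+m
    with ≽-split (≽-+ (v≡[]⇒≽ vx≡m) (≽-weaken (ℤₚ.i≤j+i m (+ 1)) y≽1+m))
  ... | inj₁ v[x+y]≡m = v[x+y]≡m
  ... | inj₂ x+y≽1+m  = contradiction (≽-cong cancel (≽-+ x+y≽1+m (≽-neg y≽1+m))) (v≡[]⇒⋡ vx≡m)
    where
    cancel : x + y - y ≈ x
    cancel = trans (+-assoc x y (- y)) (trans (+-congˡ (-‿inverseʳ y)) (+-identityʳ x))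

  sum-split : ∀ {k m} (x : Fin k → Carrier) i → (∀ j → j ≢ i → x j ≽ m) →
              ∃ λ r → sum x ≈ x i + r × r ≽ m
  sum-split {suc k} x i x≽m = sum (removeAt x i) , sum-remove {i = i} x ,
    ≽-sum (removeAt x i) (λ j → x≽m (punchIn i j) (punchInᵢ≢i i j))

-- Congruences, and bases of a totally ramified extension

≡[mod]-sym : ∀ i j {d} → i ≡ j [mod d ] → j ≡ i [mod d ]
≡[mod]-sym i j {d} (divides q eq) = divides (ℤ.- q)
  (≡.trans (ring₁ i j) (≡.trans (cong ℤ.-_ eq) (ℤₚ.neg-distribˡ-* q (+ d))))
  where
  ring₁ : ∀ i j → j ℤ.- i ≡ ℤ.- (i ℤ.- j)
  ring₁ = solve-∀

≡[mod]-trans : ∀ i j k {d} → i ≡ j [mod d ] → j ≡ k [mod d ] → i ≡ k [mod d ]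
≡[mod]-trans i j k {d} (divides q eq) (divides r eq′) = divides (q ℤ.+ r)
  (≡.trans (ring₁ i j k) (≡.trans (cong₂ ℤ._+_ eq eq′) (≡.sym (ℤₚ.*-distribʳ-+ (+ d) q r))))
  where
  ring₁ : ∀ i j k → i ℤ.- k ≡ (i ℤ.- j) ℤ.+ (j ℤ.- k)
  ring₁ = solve-∀

module Extension {K : ValuedField c₁ ℓ₁} {L : ValuedField c₂ ℓ₂} {d : ℕ}
                 (ext : TotallyRamified K L d) where
  private
    module K where
      open ValuedField K public
      open Valuation K public
      open LinearAlgebra underlyingField _≈0? public using (linearRelation)
      open SemiringSum semiring public using (sum)
  open TotallyRamified ext
  open IsRingHomomorphism ι-homo
  open ValuedField L hiding (refl; zero)
  open Valuation L
  open RingProperties ring using (-‿distribˡ-*; x[y-z]≈xy-xz)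
  open AbelianGroupProperties +-abelianGroup
    using (inverseˡ-unique; xyx⁻¹≈y; ⁻¹-anti-homo‿-; //-rightDividesˡ)
  open SemiringSum semiring
    using (sum; sum-cong-≋; ∑-comm; *-distribˡ-sum; *-distribʳ-sum)
  open FiniteSum semiring using (sum-zero)
  open SetoidReasoning setoid

  ι-sum : ∀ {k} (x : Fin k → K.Carrier) → ι (K.sum x) ≈ sum (ι ∘ x)
  ι-sum {zero}  x = 0#-homo
  ι-sum {suc k} x = trans (+-homo (x zero) (K.sum (x ∘ suc))) (+-congˡ (ι-sum (x ∘ suc)))

  ι≈0 : ∀ {k} → k K.≈ K.0# → ι k ≈ 0#
  ι≈0 k≈0 = trans (⟦⟧-cong k≈0) 0#-homo

  -- In the basis supplied by `degree`, the elements have d + 1 coordinate vectors of length d, and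
  -- these are related over K.
  dependent : ∀ (w : Fin (suc d) → Carrier) →
    ∃ λ k → (∃ λ i → ¬ (k i K.≈ K.0#)) × sum (λ i → ι (k i) * w i) ≈ 0#
  dependent w = k , proj₁ (proj₂ solution) , (begin
    sum (λ i → ι (k i) * w i)
      ≈⟨ sum-cong-≋ (λ i → *-congˡ {ι (k i)} (proj₁ (proj₂ (proj₂ degree (w i))))) ⟩
    sum (λ i → ι (k i) * sum (λ j → ι (A i j) * B j))
      ≈⟨ sum-cong-≋ (λ i → *-distribˡ-sum (ι (k i)) (λ j → ι (A i j) * B j)) ⟩
    sum (λ i → sum (λ j → ι (k i) * (ι (A i j) * B j)))
      ≈⟨ ∑-comm (λ i j → ι (k i) * (ι (A i j) * B j)) ⟩
    sum (λ j → sum (λ i → ι (k i) * (ι (A i j) * B j)))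
      ≈⟨ sum-zero _ column ⟩
    0# ∎)
    where
    B = proj₁ degree
    A : Fin (suc d) → Fin d → K.Carrier
    A i = proj₁ (proj₂ degree (w i))
    solution = K.linearRelation d A
    k = proj₁ solution
    column : ∀ j → sum (λ i → ι (k i) * (ι (A i j) * B j)) ≈ 0#
    column j = begin
      sum (λ i → ι (k i) * (ι (A i j) * B j))
        ≈⟨ sum-cong-≋ (λ i → trans (sym (*-assoc (ι (k i)) (ι (A i j)) (B j)))
                                   (*-congʳ {B j} (sym (*-homo (k i) (A i j))))) ⟩
      sum (λ i → ι (k i K.* A i j) * B j)
        ≈⟨ *-distribʳ-sum (B j) (λ i → ι (k i K.* A i j)) ⟨
      sum (λ i → ι (k i K.* A i j)) * B j
        ≈⟨ *-congʳ (ι-sum (λ i → k i K.* A i j)) ⟨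
      ι (K.sum (λ i → k i K.* A i j)) * B j
        ≈⟨ *-congʳ (ι≈0 (proj₂ (proj₂ solution) j)) ⟩
      0# * B j
        ≈⟨ zeroˡ (B j) ⟩
      0# ∎

  -- A finite value of the product forces k to be nonzero, and ramification makes the value of `ι k`
  -- a multiple of d. Hence scalars from K do not change the residue of a value modulo d.
  v-ι-* : ∀ {k x t τ} → v (ι k * x) ≡ [ t ] → v x ≡ [ τ ] →
          ∃ λ m → K.v k ≡ [ m ] × t ≡ + d ℤ.* m ℤ.+ τ
  v-ι-* {k} {x} {t} {τ} v[kx]≡t vx≡τ with K.v k in eq
  ... | ⊤⁺    = contradiction (trans (*-congʳ (ι≈0 (Equivalence.to (K.v-∞ k) eq))) (zeroˡ x))
                              (v≡[]⇒≉0 v[kx]≡t)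
  ... | [ m ] = m , refl , []-injective (≡.trans (≡.sym v[kx]≡t) (v-*-[] (ramified k m eq) vx≡τ))

  -- Replacing x by y under a fixed scalar raises the bound by δ. The case of zero k is included,
  -- since coefficients of an expansion may vanish.
  ι-*-≽ : ∀ {k x y m τ δ} → v x ≡ [ τ ] → ι k * x ≽ m → y ≽ τ ℤ.+ δ → ι k * y ≽ m ℤ.+ δ
  ι-*-≽ {k} {x} {y} {m} {τ} {δ} vx≡τ kx≽m y≽τ+δ with K.v k in eq
  ... | ⊤⁺    = ≽-0 (trans (*-congʳ (ι≈0 (Equivalence.to (K.v-∞ k) eq))) (zeroˡ y))
  ... | [ i ] = ≽-weaken (subst (m ℤ.+ δ ℤ.≤_) (ℤₚ.+-assoc (+ d ℤ.* i) τ δ) (ℤₚ.+-monoˡ-≤ δ m≤di+τ))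
                         (≽-* (v≡[]⇒≽ (ramified k i eq)) y≽τ+δ)
    where
    m≤di+τ : m ℤ.≤ + d ℤ.* i ℤ.+ τ
    m≤di+τ = [≤]-injective (subst ([ m ] ≤∞_) (v-*-[] (ramified k i eq) vx≡τ) kx≽m)

  v-ι-*-shift : ∀ {k x y t τ δ} → v (ι k * x) ≡ [ t ] → v x ≡ [ τ ] → v y ≡ [ τ ℤ.+ δ ] →
                v (ι k * y) ≡ [ t ℤ.+ δ ]
  v-ι-*-shift {k} {x} {y} {t} {τ} {δ} v[kx]≡t vx≡τ vy≡τ+δ with v-ι-* v[kx]≡t vx≡τ
  ... | m , vk≡m , refl = ≡.trans (v-*-[] (ramified k m vk≡m) vy≡τ+δ)
                                  (cong [_] (≡.sym (ℤₚ.+-assoc (+ d ℤ.* m) τ δ)))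

  module Family (e : Fin d → Carrier) (τ : Fin d → ℤ) (v-e : ∀ j → v (e j) ≡ [ τ j ])
                (τ-injective : ∀ i j → τ i ≡ τ j [mod d ] → i ≡ j) where

    term-residue : ∀ {k j t} → v (ι k * e j) ≡ [ t ] → t ≡ τ j [mod d ]
    term-residue {j = j} v≡t with v-ι-* v≡t (v-e j)
    ... | m , _ , refl = divides m (ring₁ (+ d) m (τ j))
      where
      ring₁ : ∀ d m τ → d ℤ.* m ℤ.+ τ ℤ.- τ ≡ m ℤ.* d
      ring₁ = solve-∀

    combination : (Fin d → K.Carrier) → Carrier
    combination k = sum λ j → ι (k j) * e j

    terms-distinct : ∀ (k : Fin d → K.Carrier) i j t →
                     v (ι (k i) * e i) ≡ [ t ] → v (ι (k j) * e j) ≡ [ t ] → i ≡ j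
    terms-distinct k i j t vᵢ≡t vⱼ≡t =
      τ-injective i j (≡[mod]-trans (τ i) t (τ j) (≡[mod]-sym t (τ i) (term-residue vᵢ≡t)) (term-residue vⱼ≡t))

    -- Nonzero terms of different index have values in different classes modulo d, so the minimum is
    -- attained once and the remaining terms are a perturbation.
    leadingTerm : ∀ k → (∀ j → ι (k j) * e j ≈ 0#) ⊎
      ∃ λ j → ∃ λ t → v (ι (k j) * e j) ≡ [ t ] × (∀ i → i ≢ j → ι (k i) * e i ≽ + 1 ℤ.+ t)
                    × v (combination k) ≡ [ t ]
    leadingTerm k with uniqueMinimum (λ j → v (ι (k j) * e j)) (terms-distinct k)
    ... | inj₁ all⊤ = inj₁ λ j → Equivalence.to (v-∞ _) (all⊤ j)
    ... | inj₂ (j , t , vⱼ≡t , others) with sum-split (λ j → ι (k j) * e j) j others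
    ... | r , eq , r≽1+t = inj₂ (j , t , vⱼ≡t , others ,
      ≡.trans (v-cong eq) (v-perturb vⱼ≡t r≽1+t))

    independent : ∀ k → combination k ≈ 0# → ∀ j → k j K.≈ K.0#
    independent k sum≈0 j with leadingTerm k
    ... | inj₂ (_ , _ , _ , _ , v-sum) = contradiction sum≈0 (v≡[]⇒≉0 v-sum)
    ... | inj₁ all0 with K.v (k j) in eq
    ... | ⊤⁺    = Equivalence.to (K.v-∞ _) eq
    ... | [ m ] = contradiction (all0 j) (v≡[]⇒≉0 (v-*-[] (ramified _ m eq) (v-e j)))

    -- Together with α, the d elements `e j` are dependent. As the `e j` are independent, the
    -- coefficient of α in the relation is nonzero and can be divided out.
    expand : ∀ α → ∃ λ k → α ≈ combination k
    expand α = solve (dependent w)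
      where
      w : Fin (suc d) → Carrier
      w zero    = α
      w (suc j) = e j
      solve : (∃ λ k → (∃ λ i → ¬ (k i K.≈ K.0#)) × sum (λ i → ι (k i) * w i) ≈ 0#) →
              ∃ λ k → α ≈ combination k
      solve (k , (i , kᵢ≉0) , relation) with k zero K.≈0?
      ... | yes k₀≈0 = contradiction (allZero i) kᵢ≉0
        where
        allZero : ∀ i → k i K.≈ K.0#
        allZero zero    = k₀≈0
        allZero (suc j) = independent (k ∘ suc) (begin
          combination (k ∘ suc)                   ≈⟨ +-identityˡ _ ⟨
          0# + combination (k ∘ suc)              ≈⟨ +-congʳ (trans (*-congʳ (ι≈0 k₀≈0)) (zeroˡ α)) ⟨
          ι (k zero) * α + combination (k ∘ suc)  ≈⟨ relation ⟩
          0#                                      ∎) j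
      ... | no k₀≉0 = (λ j → K.- c K.* k (suc j)) , (begin
        α                                               ≈⟨ inverseˡ-unique α _ α+cS≈0 ⟩
        - (ι c * S)                                     ≈⟨ -‿distribˡ-* (ι c) S ⟩
        - ι c * S                                       ≈⟨ *-congʳ (-‿homo c) ⟨
        ι (K.- c) * S                                   ≈⟨ *-distribˡ-sum (ι (K.- c))
                                                             (λ j → ι (k (suc j)) * e j) ⟩
        sum (λ j → ι (K.- c) * (ι (k (suc j)) * e j))   ≈⟨ sum-cong-≋ (λ j →
            trans (sym (*-assoc (ι (K.- c)) (ι (k (suc j))) (e j)))
                  (*-congʳ {e j} (sym (*-homo (K.- c) (k (suc j)))))) ⟩
        combination (λ j → K.- c K.* k (suc j))         ∎)
        where
        c = k zero K.⁻¹
        S = combination (k ∘ suc)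
        ck₀≈1 : c K.* k zero K.≈ K.1#
        ck₀≈1 = K.trans (K.*-comm c (k zero)) (K.⁻¹-inverse (k zero) k₀≉0)
        α+cS≈0 : α + ι c * S ≈ 0#
        α+cS≈0 = begin
          α + ι c * S                          ≈⟨ +-congʳ (trans (*-congʳ 1#-homo) (*-identityˡ α)) ⟨
          ι K.1# * α + ι c * S                 ≈⟨ +-congʳ (*-congʳ (⟦⟧-cong ck₀≈1)) ⟨
          ι (c K.* k zero) * α + ι c * S       ≈⟨ +-congʳ (trans (*-congʳ (*-homo c (k zero)))
                                                            (*-assoc (ι c) (ι (k zero)) α)) ⟩
          ι c * (ι (k zero) * α) + ι c * S     ≈⟨ distribˡ (ι c) (ι (k zero) * α) S ⟨
          ι c * (ι (k zero) * α + S)           ≈⟨ *-congˡ relation ⟩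
          ι c * 0#                             ≈⟨ zeroʳ (ι c) ⟩
          0#                                   ∎

    -- The whole expansion is kept, not only its leading index: a linear map is applied term by
    -- term, and the strict bound on the other terms has to survive it.
    record Leading (α : Carrier) (t : ℤ) : Set (c₁ ⊔ ℓ₂) where
      field
        coefficient : Fin d → K.Carrier
        expansion   : α ≈ combination coefficient
        index       : Fin d
        v-term      : v (ι (coefficient index) * e index) ≡ [ t ]
        v-others    : ∀ j → j ≢ index → ι (coefficient j) * e j ≽ + 1 ℤ.+ t

      residue : t ≡ τ index [mod d ]
      residue = term-residue v-term

    abstract
      leadingOf : ∀ {α t} → v α ≡ [ t ] → Leading α t
      leadingOf {α} {t} vα≡t with expand α
      ... | k , α≈Σ with leadingTerm k
      ... | inj₁ all0 = contradiction (trans α≈Σ (sum-zero _ all0))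
                                      (v≡[]⇒≉0 vα≡t)
      ... | inj₂ (j , t′ , vⱼ≡t′ , others , v-sum)
        with refl ← []-injective (≡.trans (≡.sym vα≡t) (≡.trans (v-cong α≈Σ) v-sum)) = record
        { coefficient = k ; expansion = α≈Σ ; index = j ; v-term = vⱼ≡t′ ; v-others = others }

    private
      approximateBy : ∀ {α t} → Leading α t → ∃ λ j → t ≡ τ j [mod d ] ×
        ∃ λ k → v (ι k * e j) ≡ [ t ] × α - ι k * e j ≽ + 1 ℤ.+ t
      approximateBy {α} {t} l = index , residue , coefficient index , v-term ,
        close (sum-split (λ j → ι (coefficient j) * e j) index v-others)
        where
        open Leading l
        x = ι (coefficient index) * e index
        close : (∃ λ r → combination coefficient ≈ x + r × r ≽ + 1 ℤ.+ t) → α - x ≽ + 1 ℤ.+ t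
        close (r , eq , r≽1+t) = ≽-cong (sym (begin
          α - x          ≈⟨ +-congʳ (trans expansion eq) ⟩
          x + r - x      ≈⟨ xyx⁻¹≈y x r ⟩
          r              ∎)) r≽1+t

    abstract
      approximate : ∀ {α t} → v α ≡ [ t ] → ∃ λ j → t ≡ τ j [mod d ] ×
        ∃ λ k → v (ι k * e j) ≡ [ t ] × α - ι k * e j ≽ + 1 ℤ.+ t
      approximate vα≡t = approximateBy (leadingOf vα≡t)

    -- The class of t modulo d determines the leading index, so α and β have leading terms
    -- `ι a * e i` and `ι b * e i` with the same i, and u is a divided by b. This plays the part of
    -- the equality of the residue fields of K and L.
    unitMultiple : ∀ {α β t} → v α ≡ [ t ] → v β ≡ [ t ] →
      ∃ λ u → K.IsUnit u × α - ι u * β ≽ + 1 ℤ.+ t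
    unitMultiple {α} {β} {t} vα≡t vβ≡t with approximate vα≡t | approximate vβ≡t
    ... | i , t≡τᵢ , a , va≡t , α≈a | j , t≡τⱼ , b , vb≡t , β≈b
      with refl ← τ-injective i j (≡[mod]-trans (τ i) t (τ j) (≡[mod]-sym t (τ i) t≡τᵢ) t≡τⱼ)
      with v-ι-* va≡t (v-e i) | v-ι-* vb≡t (v-e i)
    ... | m , va≡m , t≡dm+τ | m′ , vb≡m′ , t≡dm′+τ = u , vu≡0 ,
      ≽-cong regroup (≽-+ α≈a (≽-neg (subst (ι u * (β - ι b * e i) ≽_) (zeros d t)
                                             (≽-* (v≡[]⇒≽ (ramified u (+ 0) vu≡0)) β≈b))))
      where
      b≉0 : ¬ (b K.≈ K.0#)
      b≉0 = K.v≡[]⇒≉0 vb≡m′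
      u = a K.* b K.⁻¹
      dm≡dm′ : + d ℤ.* m ≡ + d ℤ.* m′
      dm≡dm′ = ℤGroup.∙-cancelʳ (τ i) _ _ (≡.trans (≡.sym t≡dm+τ) t≡dm′+τ)
      m≡m′ : m ≡ m′
      -- The index i inhabits `Fin d`, so d is nonzero and cancels.
      m≡m′ = ℤₚ.*-cancelˡ-≡ (+ d) m m′ {{nonZeroIndex i}} dm≡dm′
      vu≡0 : K.IsUnit u
      vu≡0 = ≡.trans (K.v-*-[] va≡m (K.v-⁻¹ vb≡m′))
        (cong [_] (≡.trans (cong (ℤ._- m′) m≡m′) (ℤₚ.+-inverseʳ m′)))
      zeros : ∀ d t → + d ℤ.* + 0 ℤ.+ (+ 1 ℤ.+ t) ≡ + 1 ℤ.+ t
      zeros d t = ≡.trans (cong (ℤ._+ (+ 1 ℤ.+ t)) (ℤₚ.*-zeroʳ (+ d))) (ℤₚ.+-identityˡ (+ 1 ℤ.+ t))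
      ub≈a : ι u * ι b ≈ ι a
      ub≈a = trans (sym (*-homo u b)) (⟦⟧-cong (K.trans (K.*-assoc a (b K.⁻¹) b)
        (K.trans (K.*-congˡ (K.trans (K.*-comm (b K.⁻¹) b) (K.⁻¹-inverse b b≉0))) (K.*-identityʳ a))))
      regroup : (α - ι a * e i) - ι u * (β - ι b * e i) ≈ α - ι u * β
      regroup = begin
        (α - ι a * e i) - ι u * (β - ι b * e i)
          ≈⟨ +-congˡ (-‿cong (trans (x[y-z]≈xy-xz (ι u) β (ι b * e i))
               (+-congˡ (-‿cong (trans (sym (*-assoc (ι u) (ι b) (e i))) (*-congʳ ub≈a)))))) ⟩
        (α - ι a * e i) - (ι u * β - ι a * e i)
          ≈⟨ +-congˡ (⁻¹-anti-homo‿- (ι u * β) (ι a * e i)) ⟩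
        (α - ι a * e i) + (ι a * e i - ι u * β)
          ≈⟨ +-assoc (α - ι a * e i) (ι a * e i) (- (ι u * β)) ⟨
        α - ι a * e i + ι a * e i - ι u * β
          ≈⟨ +-congʳ (//-rightDividesˡ (ι a * e i) α) ⟩
        α - ι u * β ∎

    module _ {A : KAlgebra K c₃ ℓ₃} (action : LinearAction ext A) where
      open LinearAction action
      open IsLeftModule isLeftModule using (*ₗ-cong; *ₗ-zeroʳ; *ₗ-distribˡ)

      ·-sum : ∀ a {k} (x : Fin k → Carrier) → a · sum x ≈ sum (λ i → a · x i)
      ·-sum a {zero}  x = *ₗ-zeroʳ a
      ·-sum a {suc k} x = trans (*ₗ-distribˡ a (x zero) (sum (x ∘ suc))) (+-congˡ (·-sum a (x ∘ suc)))

      -- α has valuation t, and its leading term has index j.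
      record ShiftsLike (a : KAlgebra.Carrier A) (δ : ℤ) (α : Carrier) (t : ℤ) (j : Fin d) : Set where
        field
          exactly  : v (a · e j) ≡ [ τ j ℤ.+ δ ] → v (a · α) ≡ [ t ℤ.+ δ ]
          strictly : a · e j ≽ + 1 ℤ.+ (τ j ℤ.+ δ) → a · α ≽ + 1 ℤ.+ (t ℤ.+ δ)

      private
        1+swap : ∀ t δ → + 1 ℤ.+ (t ℤ.+ δ) ≡ t ℤ.+ (+ 1 ℤ.+ δ)
        1+swap = solve-∀

        -- The map a acts term by term. The terms other than the leading one start above t and end
        -- above t + δ, so the leading term alone decides whether the bound is attained.
        shiftsBy : ∀ a δ → (∀ j → a · e j ≽ τ j ℤ.+ δ) → ∀ {α t} (l : Leading α t) →
                   ShiftsLike a δ α t (Leading.index l)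
        shiftsBy a δ a·e≽ {α} {t} l = finish (sum-split (λ j → ι (coefficient j) * (a · e j)) index
          λ j j≢i → subst (ι (coefficient j) * (a · e j) ≽_) (≡.sym (1+assoc t δ))
                          (ι-*-≽ (v-e j) (v-others j j≢i) (a·e≽ j)))
          where
          open Leading l
          expand-a· : a · α ≈ sum λ j → ι (coefficient j) * (a · e j)
          expand-a· = trans (*ₗ-cong (KAlgebra.refl A) expansion)
            (trans (·-sum a (λ j → ι (coefficient j) * e j))
                   (sum-cong-≋ λ j → ·-linearʳ a (coefficient j) (e j)))
          x = ι (coefficient index) * (a · e index)
          finish : (∃ λ r → sum (λ j → ι (coefficient j) * (a · e j)) ≈ x + r ×
                            r ≽ + 1 ℤ.+ (t ℤ.+ δ)) → ShiftsLike a δ α t index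
          finish (r , eq , r≽) = record
            { exactly  = λ v≡ → ≡.trans (v-cong (trans expand-a· eq))
                                        (v-perturb (v-ι-*-shift v-term (v-e index) v≡) r≽)
            ; strictly = λ ≽1+ → ≽-cong (sym (trans expand-a· eq)) (≽-+
                (subst (x ≽_) (≡.sym (1+swap t δ))
                  (ι-*-≽ (v-e index) (v≡[]⇒≽ v-term) (subst (a · e index ≽_) (1+swap (τ index) δ) ≽1+)))
                r≽)
            }

      abstract
        ·-leading : ∀ a δ → (∀ j → a · e j ≽ τ j ℤ.+ δ) → ∀ {α t} → v α ≡ [ t ] →
                    ∃ λ j → t ≡ τ j [mod d ] × ShiftsLike a δ α t j
        ·-leading a δ a·e≽ vα≡t = index , residue , shiftsBy a δ a·e≽ (leadingOf vα≡t)
          where open Leading (leadingOf vα≡t) using (index; residue)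

-- Words and digits

occurrences : ∀ {n} → Fin n → List (Fin n) → ℕ
occurrences i w = length (filter (i ≟_) w)

occurrences-hit : ∀ {n} (i : Fin n) w → occurrences i (i ∷ w) ≡ suc (occurrences i w)
occurrences-hit i w = cong length (filter-accept (i ≟_) refl)

occurrences-miss : ∀ {n} {i j : Fin n} w → j ≢ i → occurrences j (i ∷ w) ≡ occurrences j w
occurrences-miss w j≢i = cong length (filter-reject (_ ≟_) j≢i)

occurrences-∷ : ∀ {n} (i j : Fin n) w → occurrences j (i ∷ w) ≡ occurrences j (i ∷ []) ℕ.+ occurrences j w
occurrences-∷ i j w with j ≟ i
... | yes _ = refl
... | no  _ = refl

occurrences-replicate-hit : ∀ {n} (i : Fin n) k w → occurrences i (replicate k i ++ w) ≡ k ℕ.+ occurrences i w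
occurrences-replicate-hit i zero    w = refl
occurrences-replicate-hit i (suc k) w =
  ≡.trans (occurrences-hit i (replicate k i ++ w)) (cong suc (occurrences-replicate-hit i k w))

occurrences-replicate-miss : ∀ {n} {i j : Fin n} k w → j ≢ i →
                             occurrences j (replicate k i ++ w) ≡ occurrences j w
occurrences-replicate-miss zero    w j≢i = refl
occurrences-replicate-miss {i = i} (suc k) w j≢i =
  ≡.trans (occurrences-miss (replicate k i ++ w) j≢i) (occurrences-replicate-miss k w j≢i)

occurrences-zero-map-suc : ∀ {n} (w : List (Fin n)) → occurrences zero (map suc w) ≡ 0
occurrences-zero-map-suc []      = refl
occurrences-zero-map-suc (i ∷ w) =
  ≡.trans (occurrences-miss {i = suc i} (map suc w) λ ()) (occurrences-zero-map-suc w)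

occurrences-suc-map-suc : ∀ {n} (i : Fin n) w → occurrences (suc i) (map suc w) ≡ occurrences i w
occurrences-suc-map-suc i []      = refl
occurrences-suc-map-suc i (j ∷ w) with i ≟ j
... | yes _ = cong suc (occurrences-suc-map-suc i w)
... | no  _ = occurrences-suc-map-suc i w

wordOf : ∀ {n} → (Fin n → ℕ) → List (Fin n)
wordOf {zero}  f = []
wordOf {suc n} f = replicate (f zero) zero ++ map suc (wordOf (f ∘ suc))

occurrences-wordOf : ∀ {n} (f : Fin n → ℕ) i → occurrences i (wordOf f) ≡ f i
occurrences-wordOf f zero =
  ≡.trans (occurrences-replicate-hit zero (f zero) (map suc (wordOf (f ∘ suc))))
  (≡.trans (cong (f zero ℕ.+_) (occurrences-zero-map-suc (wordOf (f ∘ suc)))) (ℕₚ.+-identityʳ (f zero)))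
occurrences-wordOf f (suc i) =
  ≡.trans (occurrences-replicate-miss (f zero) (map suc (wordOf (f ∘ suc))) λ ())
  (≡.trans (occurrences-suc-map-suc i (wordOf (f ∘ suc))) (occurrences-wordOf (f ∘ suc) i))

wordWithout : ∀ {n} → Fin n → (Fin n → ℕ) → List (Fin n)
wordWithout i f = wordOf (updateAt f i (const 0))

occurrences-wordWithout-hit : ∀ {n} (i : Fin n) f → occurrences i (wordWithout i f) ≡ 0
occurrences-wordWithout-hit i f = ≡.trans (occurrences-wordOf _ i) (updateAt-updates i f)

occurrences-wordWithout-miss : ∀ {n} {i j : Fin n} f → j ≢ i → occurrences j (wordWithout i f) ≡ f j
occurrences-wordWithout-miss {i = i} {j} f j≢i = ≡.trans (occurrences-wordOf _ j) (updateAt-minimal j i f j≢i)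

-- All letters i stand in front, so that prefixing one more i extends the initial block and can
-- complete it to a p-th power.
wordFrom : ∀ {n} → Fin n → (Fin n → ℕ) → List (Fin n)
wordFrom i f = replicate (f i) i ++ wordWithout i f

occurrences-wordFrom : ∀ {n} (i : Fin n) f j → occurrences j (wordFrom i f) ≡ f j
occurrences-wordFrom i f j with j ≟ i
... | yes refl = ≡.trans (occurrences-replicate-hit i (f i) (wordWithout i f))
  (≡.trans (cong (f i ℕ.+_) (occurrences-wordWithout-hit i f)) (ℕₚ.+-identityʳ (f i)))
... | no j≢i = ≡.trans (occurrences-replicate-miss (f i) (wordWithout i f) j≢i)
                       (occurrences-wordWithout-miss f j≢i)

-- Base-p digits and the arithmetic of `𝔟` and `𝔞`

module Digits (p : ℕ) (p-prime : Prime p) where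
  instance
    p-nonZero : NonZero p
    p-nonZero = prime⇒nonZero p-prime

  -- The formula of `𝔟` with arbitrary integers as digits, since injectivity of `𝔟` concerns
  -- differences of digits.
  weighted : ∀ {n} → (Fin n → ℤ) → (Fin n → ℤ) → ℤ
  weighted b h = ℤSum.sum λ i → h i ℤ.* + place p i ℤ.* b i

  small-multiple : ∀ h → ∣ h ∣ ℕ.< p → p ℕDiv.∣ ∣ h ∣ → h ≡ + 0
  small-multiple h h<p p∣h with ∣ h ∣ in eq
  ... | zero  = ℤₚ.∣i∣≡0⇒i≡0 eq
  ... | suc _ = contradiction (ℕDiv.∣⇒≤ p∣h) (ℕₚ.<⇒≱ h<p)

  -- Modulo p ^ n the leading term disappears, so the remaining digits vanish by induction. What is
  -- left is the leading term, divisible by p ^ (n + 1); hence p divides `b zero ℤ.* h zero`, and so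
  -- `h zero`, which is too small to be a nonzero multiple of p.
  weighted-independent : ∀ {n} (b : Fin n → ℤ) → (∀ i → Coprime (b i) (+ p)) →
    ∀ h → (∀ i → ∣ h i ∣ ℕ.< p) → + (p ^ n) ∣ weighted b h → ∀ i → h i ≡ + 0
  weighted-independent {suc n} b coprime h h<p pⁿ⁺¹∣ = vanish
    where
    P = + (p ^ n)
    rest = weighted (b ∘ suc) (h ∘ suc)
    p*P : + (p ^ suc n) ≡ + p ℤ.* P
    p*P = ℤₚ.pos-* p (p ^ n)
    pP∣ : + p ℤ.* P ∣ h zero ℤ.* P ℤ.* b zero ℤ.+ rest
    pP∣ = subst (_∣ h zero ℤ.* P ℤ.* b zero ℤ.+ rest) p*P pⁿ⁺¹∣
    tail≡0 : ∀ i → h (suc i) ≡ + 0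
    tail≡0 = weighted-independent (b ∘ suc) (coprime ∘ suc) (h ∘ suc) (h<p ∘ suc)
      (∣m+n∣m⇒∣n (∣-trans (∣n⇒∣m*n (+ p) ∣-refl) pP∣) (∣m⇒∣m*n (b zero) (∣n⇒∣m*n (h zero) ∣-refl)))
    rest≡0 : rest ≡ + 0
    rest≡0 = ℤSum.sum-zero _ λ i → cong (λ z → z ℤ.* + place p i ℤ.* b (suc i)) (tail≡0 i)
    leading≡ : h zero ℤ.* P ℤ.* b zero ℤ.+ rest ≡ b zero ℤ.* h zero ℤ.* P
    leading≡ = ≡.trans (cong (λ z → h zero ℤ.* P ℤ.* b zero ℤ.+ z) rest≡0) (ring₁ (h zero) P (b zero))
      where
      ring₁ : ∀ h P b → h ℤ.* P ℤ.* b ℤ.+ + 0 ≡ b ℤ.* h ℤ.* P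
      ring₁ = solve-∀
    p∣b₀h₀ : + p ∣ b zero ℤ.* h zero
    p∣b₀h₀ = *-cancelʳ-∣ P {{ℕₚ.m^n≢0 p n}} (subst (+ p ℤ.* P ∣_) leading≡ pP∣)
    vanish : ∀ i → h i ≡ + 0
    vanish (suc i) = tail≡0 i
    vanish zero    = small-multiple (h zero) (h<p zero)
      (coprime-divisor (+ p) (b zero) (h zero) (ℤCoprime.sym {b zero} {+ p} (coprime zero)) (∣⇒∣ᵤ p∣b₀h₀))

  -- Stated with `suc`, so that the induction avoids truncated subtraction.
  suc-toℕ-top : ∀ n (s : Fin (p ^ n)) → (∀ i → suc (toℕ (digit p {n} s i)) ≡ p) → suc (toℕ s) ≡ p ^ n
  suc-toℕ-top zero    zero _   = refl
  suc-toℕ-top (suc n) s    top = begin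
    suc (toℕ s)                        ≡⟨ cong (suc ∘ toℕ) (combine-remQuot {p} (p ^ n) s) ⟨
    suc (toℕ (combine q r))            ≡⟨ cong suc (toℕ-combine q r) ⟩
    suc (p ^ n ℕ.* toℕ q ℕ.+ toℕ r)    ≡⟨ ℕₚ.+-suc (p ^ n ℕ.* toℕ q) (toℕ r) ⟨
    p ^ n ℕ.* toℕ q ℕ.+ suc (toℕ r)    ≡⟨ cong (p ^ n ℕ.* toℕ q ℕ.+_) (suc-toℕ-top n r λ i → top (suc i)) ⟩
    p ^ n ℕ.* toℕ q ℕ.+ p ^ n          ≡⟨ ℕₚ.+-comm (p ^ n ℕ.* toℕ q) (p ^ n) ⟩
    p ^ n ℕ.+ p ^ n ℕ.* toℕ q          ≡⟨ ℕₚ.*-suc (p ^ n) (toℕ q) ⟨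
    p ^ n ℕ.* suc (toℕ q)              ≡⟨ cong (p ^ n ℕ.*_) (top zero) ⟩
    p ^ n ℕ.* p                        ≡⟨ ℕₚ.*-comm (p ^ n) p ⟩
    p ^ suc n                          ∎
    where
    open ≡.≡-Reasoning
    q = quotient {p} (p ^ n) s
    r = remainder {p} (p ^ n) s

  digits-injective : ∀ n (s s′ : Fin (p ^ n)) →
                     (∀ i → digit p {n} s i ≡ digit p {n} s′ i) → s ≡ s′
  digits-injective zero    zero zero _  = refl
  digits-injective (suc n) s    s′   eq =
    ≡.trans (≡.sym (combine-remQuot {p} (p ^ n) s))
    (≡.trans (cong₂ combine (eq zero) (digits-injective n _ _ λ i → eq (suc i)))
             (combine-remQuot {p} (p ^ n) s′))

  digits⇒top : ∀ n (s : Fin (p ^ n)) → (∀ i → suc (toℕ (digit p {n} s i)) ≡ p) → toℕ s ≡ p ^ n ∸ 1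
  digits⇒top n s top = cong (_∸ 1) (suc-toℕ-top n s top)

  withDigits : ∀ {n} (f : Fin n → ℕ) → (∀ i → f i ℕ.< p) → ∃ λ s → ∀ i → toℕ (digit p {n} s i) ≡ f i
  withDigits f f<p = funToFin (λ i → fromℕ< (f<p i)) ,
    λ i → ≡.trans (cong toℕ (finToFun-funToFin (λ i → fromℕ< (f<p i)) i)) (toℕ-fromℕ< (f<p i))

  -- The element all of whose digits are p - 1 exists and, by `digits⇒top`, equals s as a number.
  top⇒digits : ∀ n (s : Fin (p ^ n)) → toℕ s ≡ p ^ n ∸ 1 → ∀ i → suc (toℕ (digit p {n} s i)) ≡ p
  top⇒digits n s s≡top i = subst (λ s → suc (toℕ (digit p {n} s i)) ≡ p) top≡s (suc-digit i)
    where
    top-digits : ∃ λ s → ∀ i → toℕ (digit p {n} s i) ≡ ℕ.pred p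
    top-digits = withDigits (λ _ → ℕ.pred p) λ _ → ℕₚ.≤-reflexive (ℕₚ.suc-pred p)
    suc-digit : ∀ i → suc (toℕ (digit p {n} (proj₁ top-digits) i)) ≡ p
    suc-digit i = ≡.trans (cong suc (proj₂ top-digits i)) (ℕₚ.suc-pred p)
    top≡s : proj₁ top-digits ≡ s
    top≡s = toℕ-injective (≡.trans (digits⇒top n (proj₁ top-digits) suc-digit) (≡.sym s≡top))

  module Shifts {n : ℕ} (b : Fin n → ℤ) (coprime : ∀ i → Coprime (b i) (+ p)) where

    -- The shift of a scaffold: `shift t i` is `t ℤ.+ d i`.
    d : Fin n → ℤ
    d i = + place p i ℤ.* b i

    -- The bound of (C3) is the total shift of p applications of Ψᵢ.
    p*d : ∀ i → + p ℤ.* d i ≡ b i ℤ.* + (p ^ (n ∸ toℕ i))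
    p*d i = begin
      + p ℤ.* (+ place p i ℤ.* b i)        ≡⟨ ℤₚ.*-assoc (+ p) (+ place p i) (b i) ⟨
      + p ℤ.* + place p i ℤ.* b i          ≡⟨ cong (ℤ._* b i) (ℤₚ.pos-* p (place p i)) ⟨
      + (p ^ suc (n ∸ suc (toℕ i))) ℤ.* b i ≡⟨ cong (λ k → + (p ^ k) ℤ.* b i) (ℕₚ.+-∸-assoc 1 (toℕ<n i)) ⟨
      + (p ^ (n ∸ toℕ i)) ℤ.* b i          ≡⟨ ℤₚ.*-comm (+ (p ^ (n ∸ toℕ i))) (b i) ⟩
      b i ℤ.* + (p ^ (n ∸ toℕ i))          ∎
      where open ≡.≡-Reasoning

    -- `𝔟 p b s` is `B` at the digits of s. Working with functions allows exponents of p or more, as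
    -- occur in words.
    B : (Fin n → ℕ) → ℤ
    B f = weighted b (+_ ∘ f)

    B-cong : ∀ {f g} → (∀ i → f i ≡ g i) → B f ≡ B g
    B-cong f≗g = ℤSum.sum-cong-≗ λ i → cong (λ k → + k ℤ.* + place p i ℤ.* b i) (f≗g i)

    B-+ : ∀ f g → B (λ i → f i ℕ.+ g i) ≡ B f ℤ.+ B g
    B-+ f g = ≡.trans (ℤSum.sum-cong-≗ λ i → ring₁ (+ f i) (+ g i) (+ place p i) (b i))
                      (ℤSum.∑-distrib-+ (λ i → + f i ℤ.* + place p i ℤ.* b i)
                                        (λ i → + g i ℤ.* + place p i ℤ.* b i))
      where
      ring₁ : ∀ f g P b → (f ℤ.+ g) ℤ.* P ℤ.* b ≡ f ℤ.* P ℤ.* b ℤ.+ g ℤ.* P ℤ.* b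
      ring₁ = solve-∀

    -- Differences of numbers below p are below p in absolute value, so `weighted-independent`
    -- applies to them.
    B-injective : ∀ {f g} → (∀ i → f i ℕ.< p) → (∀ i → g i ℕ.< p) →
                  B f ≡ B g [mod p ^ n ] → ∀ i → f i ≡ g i
    B-injective {f} {g} f<p g<p Bf≡Bg i =
      ℤₚ.+-injective (ℤGroup.x∙y⁻¹≈ε⇒x≈y (+ f i) (+ g i)
        (weighted-independent b coprime (λ i → + f i ℤ.- + g i) small
          (subst (+ (p ^ n) ∣_) difference Bf≡Bg) i))
      where
      small : ∀ i → ∣ + f i ℤ.- + g i ∣ ℕ.< p
      small i = ℕₚ.≤-<-trans
        (ℕₚ.≤-trans (ℕₚ.≤-reflexive (cong ∣_∣ (ℤₚ.m-n≡m⊖n (f i) (g i)))) (ℤₚ.∣m⊝n∣≤m⊔n (f i) (g i)))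
        (ℕₚ.⊔-lub (f<p i) (g<p i))
      minus : ∀ i → + f i ℤ.* + place p i ℤ.* b i ≡
                    (+ f i ℤ.- + g i) ℤ.* + place p i ℤ.* b i ℤ.+ + g i ℤ.* + place p i ℤ.* b i
      minus i = ring₁ (+ f i) (+ g i) (+ place p i) (b i)
        where
        ring₁ : ∀ f g P b → f ℤ.* P ℤ.* b ≡ (f ℤ.- g) ℤ.* P ℤ.* b ℤ.+ g ℤ.* P ℤ.* b
        ring₁ = solve-∀
      difference : B f ℤ.- B g ≡ weighted b (λ i → + f i ℤ.- + g i)
      difference = ≡.trans (cong (ℤ._- B g) (≡.trans (ℤSum.sum-cong-≗ minus)
          (ℤSum.∑-distrib-+ (λ i → (+ f i ℤ.- + g i) ℤ.* + place p i ℤ.* b i)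
                            (λ i → + g i ℤ.* + place p i ℤ.* b i))))
        (ℤGroup.//-rightDividesʳ (B g) _)

    wt : List (Fin n) → ℤ
    wt []      = + 0
    wt (i ∷ w) = d i ℤ.+ wt w

    wt-replicate-++ : ∀ k i w → wt (replicate k i ++ w) ≡ + k ℤ.* d i ℤ.+ wt w
    wt-replicate-++ zero    i w =
      ≡.sym (≡.trans (cong (ℤ._+ wt w) (ℤₚ.*-zeroˡ (d i))) (ℤₚ.+-identityˡ (wt w)))
    wt-replicate-++ (suc k) i w =
      ≡.trans (cong (λ z → d i ℤ.+ z) (wt-replicate-++ k i w)) (ring₁ (+ k) (d i) (wt w))
      where
      ring₁ : ∀ k d w → d ℤ.+ (k ℤ.* d ℤ.+ w) ≡ (+ 1 ℤ.+ k) ℤ.* d ℤ.+ w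
      ring₁ = solve-∀

    B-single : ∀ i → B (λ j → occurrences j (i ∷ [])) ≡ d i
    B-single i = ≡.trans (ℤSum.sum-single _ i λ j j≢i →
        cong (λ k → + k ℤ.* + place p j ℤ.* b j) (occurrences-miss {i = i} {j} [] j≢i))
      (≡.trans (cong (λ k → + k ℤ.* + place p i ℤ.* b i) (occurrences-hit i []))
               (cong (ℤ._* b i) (ℤₚ.*-identityˡ (+ place p i))))

    B-occurrences : ∀ w → B (λ i → occurrences i w) ≡ wt w
    B-occurrences []      = ℤSum.sum-zero (λ (i : Fin n) → + 0) λ i → refl
    B-occurrences (i ∷ w) = begin
      B (λ j → occurrences j (i ∷ w))
        ≡⟨ B-cong (λ j → occurrences-∷ i j w) ⟩
      B (λ j → occurrences j (i ∷ []) ℕ.+ occurrences j w)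
        ≡⟨ B-+ (λ j → occurrences j (i ∷ [])) (λ j → occurrences j w) ⟩
      B (λ j → occurrences j (i ∷ [])) ℤ.+ B (λ j → occurrences j w)
        ≡⟨ cong₂ ℤ._+_ (B-single i) (B-occurrences w) ⟩
      d i ℤ.+ wt w ∎
      where open ≡.≡-Reasoning

    𝔟-injective : ∀ s s′ → 𝔟 p b s ≡ 𝔟 p b s′ [mod p ^ n ] → s ≡ s′
    𝔟-injective s s′ eq = digits-injective n s s′ λ i → toℕ-injective
      (B-injective (λ i → toℕ<n (digit p s i)) (λ i → toℕ<n (digit p s′ i)) eq i)

    dig : ℤ → Fin n → ℕ
    dig t i = toℕ (digit p (𝔞 p p-prime b coprime t) i)

    dig<p : ∀ t i → dig t i ℕ.< p
    dig<p t i = toℕ<n (digit p (𝔞 p p-prime b coprime t) i)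

    dig-spec : ∀ t → B (dig t) ≡ ℤ.- t [mod p ^ n ]
    dig-spec = 𝔞-spec p p-prime b coprime

    dig-unique : ∀ {f} t → (∀ i → f i ℕ.< p) → B f ≡ ℤ.- t [mod p ^ n ] → ∀ i → f i ≡ dig t i
    dig-unique {f} t f<p Bf≡-t = B-injective f<p (dig<p t)
      (≡[mod]-trans (B f) (ℤ.- t) (B (dig t)) Bf≡-t (≡[mod]-sym (B (dig t)) (ℤ.- t) (dig-spec t)))

    dig-cong : ∀ t u → t ≡ u [mod p ^ n ] → ∀ i → dig t i ≡ dig u i
    dig-cong t u (divides q eq) = dig-unique u (dig<p t)
      (≡[mod]-trans (B (dig t)) (ℤ.- t) (ℤ.- u) (dig-spec t) (divides (ℤ.- q)
        (≡.trans (ring₁ t u) (≡.trans (cong ℤ.-_ eq) (ℤₚ.neg-distribˡ-* q (+ (p ^ n)))))))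
      where
      ring₁ : ∀ t u → ℤ.- t ℤ.- ℤ.- u ≡ ℤ.- (t ℤ.- u)
      ring₁ = solve-∀

    -- The digits decrease because 𝔟 (𝔞 t) ≡ - t; there are no borrows.
    dig-shift : ∀ {f} t → (∀ i → f i ℕ.≤ dig t i) → ∀ i → f i ℕ.+ dig (t ℤ.+ B f) i ≡ dig t i
    dig-shift {f} t f≤ i = ≡.trans
      (cong (f i ℕ.+_) (≡.sym (dig-unique (t ℤ.+ B f) g<p Bg≡ i)))
      (ℕₚ.m+[n∸m]≡n (f≤ i))
      where
      g : Fin n → ℕ
      g i = dig t i ∸ f i
      g<p : ∀ i → g i ℕ.< p
      g<p i = ℕₚ.≤-<-trans (ℕₚ.m∸n≤m (dig t i) (f i)) (dig<p t i)
      Bf+Bg : B f ℤ.+ B g ≡ B (dig t)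
      Bf+Bg = ≡.trans (≡.sym (B-+ f g)) (B-cong λ i → ℕₚ.m+[n∸m]≡n (f≤ i))
      ring₁ : ∀ x y t → y ℤ.- ℤ.- (t ℤ.+ x) ≡ (x ℤ.+ y) ℤ.- ℤ.- t
      ring₁ = solve-∀
      Bg≡ : B g ≡ ℤ.- (t ℤ.+ B f) [mod p ^ n ]
      Bg≡ = subst (+ (p ^ n) ∣_)
        (≡.sym (≡.trans (ring₁ (B f) (B g) t) (cong (ℤ._- ℤ.- t) Bf+Bg))) (dig-spec t)

    dig-shift-word : ∀ {t} w → (∀ i → occurrences i w ℕ.≤ dig t i) →
                     ∀ i → occurrences i w ℕ.+ dig (t ℤ.+ wt w) i ≡ dig t i
    dig-shift-word {t} w occ≤ i =
      subst (λ z → occurrences i w ℕ.+ dig (t ℤ.+ z) i ≡ dig t i) (B-occurrences w) (dig-shift t occ≤ i)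

    -- Every digit of `𝔞` at r is p - 1, so any f with values below p can be subtracted from it
    -- digit by digit.
    dig-complement : ∀ {f} r t → (∀ i → suc (dig r i) ≡ p) → (∀ i → f i ℕ.< p) →
                     t ≡ r ℤ.+ B f [mod p ^ n ] → ∀ i → suc (f i ℕ.+ dig t i) ≡ p
    dig-complement {f} r t top f<p t≡ i = ≡.trans (cong suc
      (≡.trans (cong (f i ℕ.+_) (dig-cong t (r ℤ.+ B f) t≡ i)) (dig-shift r f≤ i))) (top i)
      where
      f≤ : ∀ i → f i ℕ.≤ dig r i
      f≤ i = ℕₚ.≤-pred (ℕₚ.≤-trans (f<p i) (ℕₚ.≤-reflexive (≡.sym (top i))))

-- Scaffolds

module Theorem
  (p n : ℕ) (p-prime : Prime p)
  {K : ValuedField c₁ ℓ₁} {L : ValuedField c₂ ℓ₂} (ext : TotallyRamified K L (p ^ n))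
  (A : KAlgebra K c₃ ℓ₃) (action : LinearAction ext A)
  (b : Fin n → ℤ) (b-coprime : ∀ i → Coprime (b i) (+ p))
  (Ψ : Fin n → KAlgebra.Carrier A)
  where

  private
    module K where
      open ValuedField K public
      open Valuation K public
    module A where
      open KAlgebra A public
      open Exp semiring public using (_^_)
  open Scaffolds p n p-prime ext A action b b-coprime hiding (occurrences)
  open TotallyRamified ext using (ι; ι-homo; ramified)
  open IsRingHomomorphism ι-homo using (⟦⟧-cong; *-homo; 1#-homo)
  open LinearAction action
  open IsLeftModule isLeftModule
    using (*ₗ-congˡ; *ₗ-congʳ; *ₗ-zeroʳ; *ₗ-zeroˡ; *ₗ-distribˡ; *ₗ-assoc; *ₗ-identityˡ)
  open Extension ext
  open Digits p p-prime
  open Shifts b b-coprime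
  open ValuedField L hiding (refl; zero)
  open Valuation L
  open AbelianGroupProperties +-abelianGroup using (//-rightDividesˡ)

  mon : List (Fin n) → A.Carrier
  mon = monomial Ψ

  mon-∷ : ∀ i w x → mon (i ∷ w) · x ≈ Ψ i · (mon w · x)
  mon-∷ i w x = *ₗ-assoc (Ψ i) (mon w) x

  mon-replicate : ∀ k i w x → mon (replicate k i ++ w) · x ≈ (Ψ i A.^ k) · (mon w · x)
  mon-replicate zero    i w x = sym (*ₗ-identityˡ (mon w · x))
  mon-replicate (suc k) i w x = trans (mon-∷ i (replicate k i ++ w) x)
    (trans (*ₗ-congˡ (mon-replicate k i w x)) (sym (*ₗ-assoc (Ψ i) (Ψ i A.^ k) (mon w · x))))

  -- Whatever the tolerance, the converse direction extracts only this strict bound from a scaffold;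
  -- for tolerance 1, `≽⇒congruent` goes back.
  congruent⇒≽ : ∀ {x y l m 𝔗} → [ 1 ] ≤ᵀ 𝔗 → v l ≡ [ m ] → x ≈ y [mod l 𝔓^ 𝔗 ] → x - y ≽ + 1 ℤ.+ m
  congruent⇒≽ {m = m} [ 1≤T ]ᵀ vl≡m (congruent {T} z z≽T eq) = ≽-cong (sym eq) (≽-weaken
    (ℤₚ.≤-trans (ℤₚ.≤-reflexive (ℤₚ.+-comm (+ 1) m)) (ℤₚ.+-monoʳ-≤ m (ℤ.+≤+ 1≤T))) (≽-* (v≡[]⇒≽ vl≡m) z≽T))
  congruent⇒≽ {y = y} _ _ (equal x≈y) = ≽-0 (trans (+-congʳ x≈y) (-‿inverseʳ y))

  ≽⇒congruent : ∀ {x y l m} → v l ≡ [ m ] → x - y ≽ + 1 ℤ.+ m → x ≈ y [mod l 𝔓^ [ 1 ] ]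
  ≽⇒congruent {x} {y} {l} {m} vl≡m x-y≽ = congruent (l ⁻¹ * (x - y))
    (subst (l ⁻¹ * (x - y) ≽_) (ring₁ m) (≽-* (v≡[]⇒≽ (v-⁻¹ vl≡m)) x-y≽))
    (sym (trans (sym (*-assoc l (l ⁻¹) (x - y)))
         (trans (*-congʳ (⁻¹-inverse l (v≡[]⇒≉0 vl≡m))) (*-identityˡ (x - y)))))
    where
    ring₁ : ∀ m → ℤ.- m ℤ.+ (+ 1 ℤ.+ m) ≡ + 1
    ring₁ = solve-∀

  -- The two cases of a scaffold of tolerance 1, expressed by values alone and for an arbitrary
  -- element in place of λ_t.
  record Shifted (i : Fin n) (α : Carrier) (t : ℤ) : Set where
    field
      lowers : 1 ℕ.≤ dig t i → v (Ψ i · α) ≡ [ t ℤ.+ d i ]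
      kills  : dig t i ≡ 0 → Ψ i · α ≽ + 1 ℤ.+ (t ℤ.+ d i)

    atLeast : Ψ i · α ≽ t ℤ.+ d i
    atLeast with dig t i in eq
    ... | zero  = ≽-weaken (ℤₚ.i≤j+i (t ℤ.+ d i) (+ 1)) (kills eq)
    ... | suc k = v≡[]⇒≽ (lowers (subst (1 ℕ.≤_) (≡.sym eq) (ℕ.s≤s ℕ.z≤n)))

  -- Both directions pass through this property: it follows from (C1), (C2) and (C3) and also from a
  -- scaffold, and it yields the congruences of tolerance 1 as well as (C2) and (C3).
  Shifting : Set c₂
  Shifting = ∀ i {α t} → v α ≡ [ t ] → Shifted i α t

  Ψ-≽ : ∀ i → (∀ {α t} → v α ≡ [ t ] → Ψ i · α ≽ t ℤ.+ d i) → ∀ {α m} → α ≽ m → Ψ i · α ≽ m ℤ.+ d i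
  Ψ-≽ i atLeast {α} {m} α≽m with α ≈0?
  ... | yes α≈0 = ≽-0 (trans (*ₗ-congˡ α≈0) (*ₗ-zeroʳ (Ψ i)))
  ... | no  α≉0 = ≽-weaken (ℤₚ.+-monoˡ-≤ (d i) ([≤]-injective (subst ([ m ] ≤∞_) (v-ord α α≉0) α≽m)))
                          (atLeast (v-ord α α≉0))

  module _ (e : Fin (p ^ n) → Carrier) (τ : Fin (p ^ n) → ℤ) (v-e : ∀ j → v (e j) ≡ [ τ j ])
           (τ-injective : ∀ i j → τ i ≡ τ j [mod p ^ n ] → i ≡ j) where
    open Family e τ v-e τ-injective

    -- If j is the leading index of α, then t and `τ j` are congruent modulo p ^ n. Their digits
    -- agree, so α falls into the same case as `e j`.
    shifted-basis : ∀ i → (∀ j → Shifted i (e j) (τ j)) → ∀ {α t} → v α ≡ [ t ] → Shifted i α t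
    shifted-basis i basis {α} {t} vα≡t =
      transfer (·-leading action (Ψ i) (d i) (λ j → Shifted.atLeast (basis j)) vα≡t)
      where
      transfer : (∃ λ j → t ≡ τ j [mod p ^ n ] × ShiftsLike action (Ψ i) (d i) α t j) → Shifted i α t
      transfer (j , t≡τⱼ , like) = record
        { lowers = λ 1≤ → exactly (lowers (subst (1 ℕ.≤_) same 1≤))
        ; kills  = λ ≡0 → strictly (kills (≡.trans (≡.sym same) ≡0))
        }
        where
        open ShiftsLike like
        open Shifted (basis j)
        same : dig t i ≡ dig (τ j) i
        same = dig-cong t (τ j) t≡τⱼ i

  -- From the shifting property to (C2) and (C3)

  module FromShifting (shifting : Shifting) where

    -- The last letter acts first. While the digits of `𝔞` at t suffice, each letter i lowers the
    -- i-th digit by one and shifts the value by exactly `d i`. A letter that meets the digit 0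
    -- causes an excess, which persists because every further letter j raises bounds by at least
    -- `d j`.
    shiftWord : ∀ {α t} → v α ≡ [ t ] → ∀ w →
      ((∀ j → occurrences j w ℕ.≤ dig t j) × v (mon w · α) ≡ [ t ℤ.+ wt w ])
      ⊎ ((∃ λ j → dig t j ℕ.< occurrences j w) × mon w · α ≽ + 1 ℤ.+ (t ℤ.+ wt w))
    shiftWord {α} {t} vα≡t [] = inj₁ ((λ j → ℕ.z≤n) ,
      ≡.trans (v-cong (*ₗ-identityˡ α)) (≡.trans vα≡t (cong [_] (≡.sym (ℤₚ.+-identityʳ t)))))
    shiftWord {α} {t} vα≡t (i ∷ w) with shiftWord vα≡t w
    ... | inj₂ ((j , dig<occ) , ≽1+) = inj₂ ((j , ℕₚ.<-≤-trans dig<occ occ≤) ,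
      ≽-cong (sym (mon-∷ i w α)) (subst (Ψ i · (mon w · α) ≽_) (ring₁ t (wt w) (d i))
        (Ψ-≽ i (λ v≡ → Shifted.atLeast (shifting i v≡)) ≽1+)))
      where
      occ≤ : occurrences j w ℕ.≤ occurrences j (i ∷ w)
      occ≤ = subst (occurrences j w ℕ.≤_) (≡.sym (occurrences-∷ i j w)) (ℕₚ.m≤n+m _ _)
      ring₁ : ∀ t w d → + 1 ℤ.+ (t ℤ.+ w) ℤ.+ d ≡ + 1 ℤ.+ (t ℤ.+ (d ℤ.+ w))
      ring₁ = solve-∀
    ... | inj₁ (occ≤dig , v≡) with dig (t ℤ.+ wt w) i in eq
    -- The digit is used up: w already contains i exactly `dig t i` times, and one more i exceeds
    -- it.
    ... | zero = inj₂ ((i , ℕₚ.≤-reflexive (≡.trans (cong suc (≡.sym full)) (≡.sym (occurrences-hit i w)))) ,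
      ≽-cong (sym (mon-∷ i w α)) (subst (Ψ i · (mon w · α) ≽_) (cong (λ z → + 1 ℤ.+ z) (ring₁ t (wt w) (d i)))
        (Shifted.kills (shifting i v≡) eq)))
      where
      full : occurrences i w ≡ dig t i
      full = ≡.trans (≡.sym (≡.trans (cong (occurrences i w ℕ.+_) eq) (ℕₚ.+-identityʳ _)))
                     (dig-shift-word w occ≤dig i)
      ring₁ : ∀ t w d → t ℤ.+ w ℤ.+ d ≡ t ℤ.+ (d ℤ.+ w)
      ring₁ = solve-∀
    ... | suc k = inj₁ (occ≤ , ≡.trans (v-cong (mon-∷ i w α))
        (≡.trans (Shifted.lowers (shifting i v≡) (subst (1 ℕ.≤_) (≡.sym eq) (ℕ.s≤s ℕ.z≤n)))
                 (cong [_] (ring₁ t (wt w) (d i)))))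
      where
      room : suc (occurrences i w) ℕ.≤ dig t i
      room = ℕₚ.≤-trans (ℕ.s≤s (ℕₚ.m≤m+n (occurrences i w) k)) (ℕₚ.≤-reflexive
        (≡.trans (≡.sym (≡.trans (cong (occurrences i w ℕ.+_) eq) (ℕₚ.+-suc _ k)))
                 (dig-shift-word w occ≤dig i)))
      occ≤ : ∀ j → occurrences j (i ∷ w) ℕ.≤ dig t j
      occ≤ j with j ≟ i
      ... | yes refl = room
      ... | no  j≢i  = occ≤dig j
      ring₁ : ∀ t w d → t ℤ.+ w ℤ.+ d ≡ t ℤ.+ (d ℤ.+ w)
      ring₁ = solve-∀

    -- No digit can accommodate p copies of i, so `shiftWord` is in its second case.
    shifting⇒C3 : C3 Ψ
    shifting⇒C3 i α α≉0 =
      subst (λ a → a +∞ [ b i ℤ.* + (p ^ (n ∸ toℕ i)) ] <∞ v ((Ψ i A.^ p) · α)) (≡.sym vα≡t)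
      (1+≤∞⇒<∞ (conclude (shiftWord vα≡t w)))
      where
      t = ord α α≉0
      vα≡t = v-ord α α≉0
      w = replicate p i ++ []
      wt≡ : wt w ≡ b i ℤ.* + (p ^ (n ∸ toℕ i))
      wt≡ = ≡.trans (wt-replicate-++ p i []) (≡.trans (ℤₚ.+-identityʳ _) (p*d i))
      conclude : _ → (Ψ i A.^ p) · α ≽ + 1 ℤ.+ (t ℤ.+ b i ℤ.* + (p ^ (n ∸ toℕ i)))
      conclude (inj₁ (occ≤ , _)) = contradiction
        (subst (ℕ._≤ dig t i) (≡.trans (occurrences-replicate-hit i p []) (ℕₚ.+-identityʳ p)) (occ≤ i))
        (ℕₚ.<⇒≱ (dig<p t i))
      conclude (inj₂ (_ , ≽1+)) = ≽-cong
        (trans (mon-replicate p i [] α) (*ₗ-congˡ (*ₗ-identityˡ α)))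
        (subst (λ z → mon w · α ≽ + 1 ℤ.+ (t ℤ.+ z)) wt≡ ≽1+)

    -- With all digits equal to p - 1, no word with exponents below p exhausts one of them.
    -- `shiftWord` compares occurrences only, so the order of the factors is arbitrary.
    shifting⇒C2 : ∀ ρ (ρ≉0 : ¬ (ρ ≈ 0#)) → toℕ (𝔞ᵇ (ord ρ ρ≉0)) ≡ p ^ n ∸ 1 → C2 Ψ ρ
    shifting⇒C2 ρ ρ≉0 top s x (w , occ≡ , x≈w) = ≡.trans (v-cong (*ₗ-congʳ x≈w))
      (≡.trans (conclude (shiftWord vρ≡r w)) (cong (_+∞ [ 𝔟 p b s ]) (≡.sym vρ≡r)))
      where
      r = ord ρ ρ≉0
      vρ≡r = v-ord ρ ρ≉0
      wt≡ : wt w ≡ 𝔟 p b s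
      wt≡ = ≡.trans (≡.sym (B-occurrences w)) (B-cong occ≡)
      conclude : _ → v (mon w · ρ) ≡ [ r ℤ.+ 𝔟 p b s ]
      conclude (inj₁ (_ , v≡)) = ≡.trans v≡ (cong (λ z → [ r ℤ.+ z ]) wt≡)
      conclude (inj₂ ((j , dig<occ) , _)) = contradiction
        (subst (ℕ._< p) (≡.sym (occ≡ j)) (toℕ<n (digit p s j)))
        (ℕₚ.≤⇒≯ (ℕₚ.≤-trans (ℕₚ.≤-reflexive (≡.sym (top⇒digits n (𝔞ᵇ r) top j))) dig<occ))

  -- The λ_t with t = - 𝔟(s) represent each residue class modulo p ^ n once. They form a basis on
  -- which the congruences of the scaffold give `Shifted` directly.
  scaffold⇒shifting : ∀ {lam 𝔗} → IsScaffold lam Ψ 𝔗 → Shifting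
  scaffold⇒shifting {lam} {𝔗} scaffold i =
    shifted-basis (lam ∘ τ) τ (v-lam ∘ τ) τ-injective i (λ s → shifted-lam (τ s))
    where
    open IsScaffold scaffold
    open IsFamily isFamily
    τ : Fin (p ^ n) → ℤ
    τ s = ℤ.- 𝔟 p b s
    τ-injective : ∀ s s′ → τ s ≡ τ s′ [mod p ^ n ] → s ≡ s′
    τ-injective s s′ eq = 𝔟-injective s s′ (≡[mod]-sym (𝔟 p b s′) (𝔟 p b s)
      (subst (+ (p ^ n) ∣_) (ring₁ (𝔟 p b s) (𝔟 p b s′)) eq))
      where
      ring₁ : ∀ i j → ℤ.- i ℤ.- ℤ.- j ≡ j ℤ.- i
      ring₁ = solve-∀
    shifted-lam : ∀ t → Shifted i (lam t) t
    shifted-lam t = record { lowers = λ 1≤ → lower (Ψ·lam-≥1 i t 1≤) ; kills = kill }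
      where
      t′ = shift t i
      lower : (∃ λ u → K.IsUnit u × ((Ψ i · lam t) ≈ (ι u * lam t′) [mod lam t′ 𝔓^ 𝔗 ])) →
              v (Ψ i · lam t) ≡ [ t′ ]
      lower (u , vu≡0 , close) = ≡.trans
        (v-cong (sym (trans (+-comm _ _) (//-rightDividesˡ (ι u * lam t′) (Ψ i · lam t)))))
        (v-perturb (≡.trans (v-*-[] (ramified u (+ 0) vu≡0) (v-lam t′))
            (cong [_] (≡.trans (cong (ℤ._+ t′) (ℤₚ.*-zeroʳ (+ (p ^ n)))) (ℤₚ.+-identityˡ t′))))
          (congruent⇒≽ 1≤𝔗 (v-lam t′) close))
      kill : dig t i ≡ 0 → Ψ i · lam t ≽ + 1 ℤ.+ t′
      kill ≡0 = ≽-cong (trans (+-congˡ -0≈0) (+-identityʳ (Ψ i · lam t)))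
        (congruent⇒≽ 1≤𝔗 (v-lam t′) (Ψ·lam-≡0 i t ≡0))
        where
        -0≈0 : - 0# ≈ 0#
        -0≈0 = trans (sym (+-identityˡ (- 0#))) (-‿inverseʳ 0#)

  -- From (C1), (C2) and (C3) to a scaffold of tolerance 1

  module FromValuations (ρ : Carrier) (ρ≉0 : ¬ (ρ ≈ 0#)) (c1 : C1 Ψ) (c3 : C3 Ψ) (c2 : C2 Ψ ρ) where

    r : ℤ
    r = ord ρ ρ≉0

    vρ≡r : v ρ ≡ [ r ]
    vρ≡r = v-ord ρ ρ≉0

    digs : Fin (p ^ n) → Fin n → ℕ
    digs s i = toℕ (digit p s i)

    digs<p : ∀ s i → digs s i ℕ.< p
    digs<p s i = toℕ<n (digit p s i)

    -- Exponents below p are the digits of some s, so the word is a monomial to which (C2) applies.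
    v-word : ∀ w → (∀ i → occurrences i w ℕ.< p) → v (mon w · ρ) ≡ [ r ℤ.+ wt w ]
    v-word w occ<p = fromDigits (withDigits (λ i → occurrences i w) occ<p)
      where
      fromDigits : (∃ λ s → ∀ i → toℕ (digit p {n} s i) ≡ occurrences i w) →
                   v (mon w · ρ) ≡ [ r ℤ.+ wt w ]
      fromDigits (s , digits) = ≡.trans (c2 s (mon w) (w , ≡.sym ∘ digits , A.refl))
        (cong₂ _+∞_ vρ≡r (cong [_] (≡.trans (B-cong digits) (B-occurrences w))))

    τ : Fin (p ^ n) → ℤ
    τ s = r ℤ.+ 𝔟 p b s

    τ-injective : ∀ s s′ → τ s ≡ τ s′ [mod p ^ n ] → s ≡ s′
    τ-injective s s′ eq = 𝔟-injective s s′ (subst (+ (p ^ n) ∣_) (ring₁ r (𝔟 p b s) (𝔟 p b s′)) eq)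
      where
      ring₁ : ∀ r i j → (r ℤ.+ i) ℤ.- (r ℤ.+ j) ≡ i ℤ.- j
      ring₁ = solve-∀

    word : Fin n → Fin (p ^ n) → List (Fin n)
    word i s = wordFrom i (digs s)

    wt-word : ∀ i s → wt (word i s) ≡ 𝔟 p b s
    wt-word i s = ≡.trans (≡.sym (B-occurrences (word i s))) (B-cong (occurrences-wordFrom i (digs s)))

    -- The basis depends on i because the factors may not commute: those equal to Ψᵢ have to be on
    -- the left when Ψᵢ is applied.
    e : Fin n → Fin (p ^ n) → Carrier
    e i s = mon (word i s) · ρ

    v-e : ∀ i s → v (e i s) ≡ [ τ s ]
    v-e i s = ≡.trans
      (v-word (word i s) λ j → subst (ℕ._< p) (≡.sym (occurrences-wordFrom i (digs s) j)) (digs<p s j))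
      (cong (λ z → [ r ℤ.+ z ]) (wt-word i s))

    r+wt-∷ : ∀ i s → r ℤ.+ wt (i ∷ word i s) ≡ τ s ℤ.+ d i
    r+wt-∷ i s = ≡.trans (cong (λ z → r ℤ.+ (d i ℤ.+ z)) (wt-word i s)) (ring₁ r (d i) (𝔟 p b s))
      where
      ring₁ : ∀ r d x → r ℤ.+ (d ℤ.+ x) ≡ r ℤ.+ x ℤ.+ d
      ring₁ = solve-∀

    e-lowers : ∀ i s → suc (digs s i) ℕ.< p → v (Ψ i · e i s) ≡ [ τ s ℤ.+ d i ]
    e-lowers i s room = ≡.trans (v-cong (sym (mon-∷ i (word i s) ρ)))
      (≡.trans (v-word (i ∷ word i s) occ<p) (cong [_] (r+wt-∷ i s)))
      where
      occ<p : ∀ j → occurrences j (i ∷ word i s) ℕ.< p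
      occ<p j with j ≟ i
      ... | yes refl = subst (λ k → suc k ℕ.< p) (≡.sym (occurrences-wordFrom i (digs s) i)) room
      ... | no  j≢i  = subst (ℕ._< p) (≡.sym (occurrences-wordFrom i (digs s) j)) (digs<p s j)

    -- One more Ψᵢ completes the block of p - 1 factors to a p-th power. (C3) is applied to the rest
    -- of the monomial acting on ρ, whose value is known from (C2).
    e-kills : ∀ i s → suc (digs s i) ≡ p → Ψ i · e i s ≽ + 1 ℤ.+ (τ s ℤ.+ d i)
    e-kills i s full = ≽-cong
      (sym (trans (sym (mon-∷ i (word i s) ρ))
        (trans (*ₗ-congʳ (A.reflexive (cong mon unfold))) (mon-replicate p i rest ρ))))
      (subst ((Ψ i A.^ p) · (mon rest · ρ) ≽_) (cong (λ z → + 1 ℤ.+ z) total)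
        (<∞⇒1+≤∞ (subst (λ a → a +∞ [ b i ℤ.* + (p ^ (n ∸ toℕ i)) ] <∞ v ((Ψ i A.^ p) · (mon rest · ρ)))
          v-rest (c3 i (mon rest · ρ) (v≡[]⇒≉0 v-rest)))))
      where
      rest = wordWithout i (digs s)
      unfold : i ∷ word i s ≡ replicate p i ++ rest
      unfold = cong (λ k → replicate k i ++ rest) full
      occ<p : ∀ j → occurrences j rest ℕ.< p
      occ<p j with j ≟ i
      ... | yes refl = subst (ℕ._< p) (≡.sym (occurrences-wordWithout-hit i (digs s)))
                               (ℕₚ.≤-<-trans ℕ.z≤n (digs<p s i))
      ... | no  j≢i  = subst (ℕ._< p) (≡.sym (occurrences-wordWithout-miss (digs s) j≢i)) (digs<p s j)
      v-rest : v (mon rest · ρ) ≡ [ r ℤ.+ wt rest ]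
      v-rest = v-word rest occ<p
      ring₁ : ∀ r x y → r ℤ.+ x ℤ.+ y ≡ r ℤ.+ (y ℤ.+ x)
      ring₁ = solve-∀
      total : r ℤ.+ wt rest ℤ.+ b i ℤ.* + (p ^ (n ∸ toℕ i)) ≡ τ s ℤ.+ d i
      total = begin
        r ℤ.+ wt rest ℤ.+ b i ℤ.* + (p ^ (n ∸ toℕ i))  ≡⟨ cong (λ z → r ℤ.+ wt rest ℤ.+ z) (p*d i) ⟨
        r ℤ.+ wt rest ℤ.+ + p ℤ.* d i                  ≡⟨ ring₁ r (wt rest) (+ p ℤ.* d i) ⟩
        r ℤ.+ (+ p ℤ.* d i ℤ.+ wt rest)                ≡⟨ cong (λ z → r ℤ.+ z) (wt-replicate-++ p i rest) ⟨
        r ℤ.+ wt (replicate p i ++ rest)               ≡⟨ cong (λ w → r ℤ.+ wt w) unfold ⟨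
        r ℤ.+ wt (i ∷ word i s)                        ≡⟨ r+wt-∷ i s ⟩
        τ s ℤ.+ d i                                    ∎
        where open ≡.≡-Reasoning

    module Basis (i : Fin n) = Family (e i) τ (v-e i) τ-injective

    -- Only the inequality common to both cases, obtained from the digits of s. Their relation to
    -- the digits of `𝔞` rests on `dig-r`, whose proof uses this bound.
    Ψ-raises : ∀ i {α m} → α ≽ m → Ψ i · α ≽ m ℤ.+ d i
    Ψ-raises i = Ψ-≽ i λ vα≡t → fromLeading (Basis.·-leading i action (Ψ i) (d i) basis-raised vα≡t)
      where
      splitDigit : ∀ s → suc (digs s i) ℕ.< p ⊎ suc (digs s i) ≡ p
      splitDigit s = ℕₚ.m≤n⇒m<n∨m≡n (digs<p s i)
      basis-raised : ∀ s → Ψ i · e i s ≽ τ s ℤ.+ d i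
      basis-raised s with splitDigit s
      ... | inj₁ room = v≡[]⇒≽ (e-lowers i s room)
      ... | inj₂ full = ≽-weaken (ℤₚ.i≤j+i (τ s ℤ.+ d i) (+ 1)) (e-kills i s full)
      fromLeading : ∀ {α t} →
                    (∃ λ s → t ≡ τ s [mod p ^ n ] × Basis.ShiftsLike i action (Ψ i) (d i) α t s) →
                    Ψ i · α ≽ t ℤ.+ d i
      fromLeading {t = t} (s , _ , like) with splitDigit s
      ... | inj₁ room = v≡[]⇒≽ (Basis.ShiftsLike.exactly like (e-lowers i s room))
      ... | inj₂ full = ≽-weaken (ℤₚ.i≤j+i (t ℤ.+ d i) (+ 1))
                                 (Basis.ShiftsLike.strictly like (e-kills i s full))

    Ψ·ι≈0 : ∀ i k → Ψ i · ι k ≈ 0#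
    Ψ·ι≈0 i k = trans (*ₗ-congˡ (sym (*-identityʳ (ι k))))
      (trans (·-linearʳ (Ψ i) k 1#) (trans (*-congˡ (c1 i)) (zeroʳ (ι k))))

    -- If the i-th digit of 𝔞(v ρ) were less than p - 1, then Ψ i would raise the valuation of an
    -- element α with v α ≡ 0 by exactly d i.  But α is congruent to an element of K, which Ψ i kills.
    dig-r : ∀ i → suc (dig r i) ≡ p
    dig-r i with ℕₚ.m≤n⇒m<n∨m≡n (dig<p r i)
    ... | inj₂ full = full
    ... | inj₁ room = contradiction raised (v≡[]⇒⋡ (e-lowers i s room))
      where
      -- For this s the value `τ s` is a multiple of p ^ n, hence also the value of an element of K.
      s = 𝔞ᵇ r
      q = _∣_.quotient (dig-spec r)
      ring₁ : ∀ r x → r ℤ.+ x ≡ x ℤ.- ℤ.- r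
      ring₁ = solve-∀
      τ≡ : τ s ≡ + (p ^ n) ℤ.* q
      τ≡ = ≡.trans (ring₁ r (𝔟 p b s)) (≡.trans (_∣_.equality (dig-spec r)) (ℤₚ.*-comm q (+ (p ^ n))))
      k = proj₁ (K.v-onto q)
      v-ιk : v (ι k) ≡ [ τ s ]
      v-ιk = ≡.trans (ramified k q (proj₂ (K.v-onto q))) (cong [_] (≡.sym τ≡))
      near : ∃ λ u → K.IsUnit u × e i s - ι u * ι k ≽ + 1 ℤ.+ τ s
      near = Basis.unitMultiple i (v-e i s) v-ιk
      u = proj₁ near
      killed : Ψ i · (ι u * ι k) ≈ 0#
      killed = trans (*ₗ-congˡ (sym (*-homo u k))) (Ψ·ι≈0 i (u K.* k))
      same : Ψ i · (e i s - ι u * ι k) ≈ Ψ i · e i s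
      same = begin
        Ψ i · (e i s - ι u * ι k)                             ≈⟨ +-identityʳ _ ⟨
        Ψ i · (e i s - ι u * ι k) + 0#                        ≈⟨ +-congˡ killed ⟨
        Ψ i · (e i s - ι u * ι k) + Ψ i · (ι u * ι k)         ≈⟨ *ₗ-distribˡ (Ψ i) _ _ ⟨
        Ψ i · (e i s - ι u * ι k + ι u * ι k)                 ≈⟨ *ₗ-congˡ (//-rightDividesˡ (ι u * ι k) (e i s)) ⟩
        Ψ i · e i s                                           ∎
        where open SetoidReasoning setoid
      raised : Ψ i · e i s ≽ + 1 ℤ.+ (τ s ℤ.+ d i)
      raised = ≽-cong same (subst (Ψ i · (e i s - ι u * ι k) ≽_) (≡.sym (1+assoc (τ s) (d i)))
        (Ψ-raises i (proj₂ (proj₂ near))))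

    𝔞-ρ : toℕ (𝔞ᵇ r) ≡ p ^ n ∸ 1
    𝔞-ρ = digits⇒top n (𝔞ᵇ r) dig-r

    -- By `complement`, the i-th digit of s is p - 1 exactly when that of `𝔞` at `τ s` is 0. The
    -- cases of `e-lowers` and `e-kills` thus become those of `Shifted`.
    shifting : Shifting
    shifting i = shifted-basis (e i) τ (v-e i) τ-injective i λ s → record
      { lowers = λ 1≤ → e-lowers i s (ℕₚ.≤-trans
          (ℕ.s≤s (ℕₚ.≤-trans (ℕₚ.≤-reflexive (ℕₚ.+-comm 1 (digs s i))) (ℕₚ.+-monoʳ-≤ (digs s i) 1≤)))
          (ℕₚ.≤-reflexive (complement s)))
      ; kills  = λ ≡0 → e-kills i s (≡.trans (cong suc
          (≡.sym (≡.trans (cong (digs s i ℕ.+_) ≡0) (ℕₚ.+-identityʳ (digs s i))))) (complement s))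
      }
      where
      complement : ∀ s → suc (digs s i ℕ.+ dig (τ s) i) ≡ p
      complement s = dig-complement r (τ s) dig-r (digs<p s)
        (divides (+ 0) (ℤₚ.+-inverseʳ (τ s))) i

    -- When the digit is at least 1, `Ψ i · lam t` has the value of `lam (shift t i)`, and
    -- `unitMultiple` supplies the unit.
    scaffold : ∀ lam → IsFamily lam → IsScaffold lam Ψ [ 1 ]
    scaffold lam isFamily = record
      { 1≤𝔗      = [ ℕₚ.≤-refl ]ᵀ
      ; isFamily = isFamily
      ; Ψ·1≈0    = c1
      ; Ψ·lam-≥1 = λ i t 1≤ →
          toUnit (Basis.unitMultiple i (Shifted.lowers (shifting i (v-lam t)) 1≤) (v-lam _))
      ; Ψ·lam-≡0 = λ i t ≡0 → ≽⇒congruent (v-lam _)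
          (≽-+ (Shifted.kills (shifting i (v-lam t)) ≡0) (≽-neg (≽-0 (ValuedField.refl L))))
      }
      where
      open IsFamily isFamily
      toUnit : ∀ {x m} → (∃ λ u → K.IsUnit u × x - ι u * lam m ≽ + 1 ℤ.+ m) →
               ∃ λ u → K.IsUnit u × (x ≈ (ι u * lam m) [mod lam m 𝔓^ [ 1 ] ])
      toUnit (u , vu≡0 , close) = u , vu≡0 , ≽⇒congruent (v-lam _) close

    -- The commutative case: tolerance ∞

    module Commuting (c4 : C4 Ψ) (comm : Commutative A._≈_ A._*_) where
      private
        swap : ∀ x y z → (x A.* (y A.* z)) A.≈ (y A.* (x A.* z))
        swap x y z = A.trans (A.sym (A.*-assoc x y z)) (A.trans (A.*-congʳ (comm x y)) (A.*-assoc y x z))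

      extract : ∀ i w k → occurrences i w ≡ suc k → ∃ λ w′ →
        (mon w A.≈ (Ψ i A.* mon w′)) × (∀ j → occurrences j w ≡ occurrences j (i ∷ w′))
      extract i (j ∷ w) k eq with i ≟ j
      ... | yes refl = w , A.refl , λ _ → refl
      ... | no  _    with extract i w k eq
      ... | w′ , w≈ , occ≡ = j ∷ w′ , A.trans (A.*-congˡ w≈) (swap (Ψ j) (Ψ i) (mon w′)) , reorder
        where
        open ≡.≡-Reasoning
        reorder : ∀ l → occurrences l (j ∷ w) ≡ occurrences l (i ∷ j ∷ w′)
        reorder l = begin
          occurrences l (j ∷ w)
            ≡⟨ occurrences-∷ j l w ⟩
          occurrences l (j ∷ []) ℕ.+ occurrences l w
            ≡⟨ cong (occurrences l (j ∷ []) ℕ.+_) (≡.trans (occ≡ l) (occurrences-∷ i l w′)) ⟩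
          occurrences l (j ∷ []) ℕ.+ (occurrences l (i ∷ []) ℕ.+ occurrences l w′)
            ≡⟨ ℕ+.x∙yz≈y∙xz (occurrences l (j ∷ [])) (occurrences l (i ∷ [])) (occurrences l w′) ⟩
          occurrences l (i ∷ []) ℕ.+ (occurrences l (j ∷ []) ℕ.+ occurrences l w′)
            ≡⟨ cong (occurrences l (i ∷ []) ℕ.+_) (occurrences-∷ j l w′) ⟨
          occurrences l (i ∷ []) ℕ.+ occurrences l (j ∷ w′)
            ≡⟨ occurrences-∷ i l (j ∷ w′) ⟨
          occurrences l (i ∷ j ∷ w′) ∎

      -- The first letter of w also occurs in w′, where commutativity moves it to the front; the
      -- remaining words are compared by induction.
      mon-cong : ∀ w w′ → (∀ i → occurrences i w ≡ occurrences i w′) → mon w A.≈ mon w′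
      mon-cong [] []       _  = A.refl
      mon-cong [] (i ∷ w′) eq = contradiction (≡.trans (eq i) (occurrences-hit i w′)) λ ()
      mon-cong (i ∷ w) w′  eq with extract i w′ _ (≡.trans (≡.sym (eq i)) (occurrences-hit i w))
      ... | w″ , w′≈ , occ≡ = A.trans (A.*-congˡ (mon-cong w w″ tails)) (A.sym w′≈)
        where
        tails : ∀ j → occurrences j w ≡ occurrences j w″
        tails j = ℕₚ.+-cancelˡ-≡ (occurrences j (i ∷ [])) _ _
          (≡.trans (≡.sym (occurrences-∷ i j w)) (≡.trans (eq j) (≡.trans (occ≡ j) (occurrences-∷ i j w″))))

      N : ℤ
      N = + (p ^ n)

      -- t = r + 𝔟(s) + pⁿ m with s = 𝔞(r - t)
      exponents : ℤ → Fin n → ℕ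
      exponents t = dig (r ℤ.- t)

      m : ℤ → ℤ
      m t = ℤ.- _∣_.quotient (dig-spec (r ℤ.- t))

      E : ℤ → Carrier
      E t = mon (wordOf (exponents t)) · ρ

      k : ℤ → K.Carrier
      k t = proj₁ (K.v-onto (m t))

      wt-exponents : ∀ t → wt (wordOf (exponents t)) ≡ B (exponents t)
      wt-exponents t = ≡.trans (≡.sym (B-occurrences (wordOf (exponents t))))
                               (B-cong (occurrences-wordOf (exponents t)))

      v-E : ∀ t → v (E t) ≡ [ r ℤ.+ B (exponents t) ]
      v-E t = ≡.trans
        (v-word (wordOf (exponents t)) λ j →
          subst (ℕ._< p) (≡.sym (occurrences-wordOf (exponents t) j)) (dig<p (r ℤ.- t) j))
        (cong (λ z → [ r ℤ.+ z ]) (wt-exponents t))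

      v-k : ∀ t → K.v (k t) ≡ [ m t ]
      v-k t = proj₂ (K.v-onto (m t))

      decompose : ∀ t → N ℤ.* m t ℤ.+ (r ℤ.+ B (exponents t)) ≡ t
      decompose t = solve (_∣_.quotient (dig-spec (r ℤ.- t))) N r t (B (exponents t))
                          (_∣_.equality (dig-spec (r ℤ.- t)))
        where
        ring₁ : ∀ q N r t x → N ℤ.* ℤ.- q ℤ.+ (r ℤ.+ x) ≡ (x ℤ.- ℤ.- (r ℤ.- t)) ℤ.- q ℤ.* N ℤ.+ t
        ring₁ = solve-∀
        solve : ∀ q N r t x → x ℤ.- ℤ.- (r ℤ.- t) ≡ q ℤ.* N → N ℤ.* ℤ.- q ℤ.+ (r ℤ.+ x) ≡ t
        solve q N r t x eq = ≡.trans (ring₁ q N r t x)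
          (≡.trans (cong (λ z → z ℤ.- q ℤ.* N ℤ.+ t) eq)
          (≡.trans (cong (ℤ._+ t) (ℤₚ.+-inverseʳ (q ℤ.* N))) (ℤₚ.+-identityˡ t)))

      -- The scalar accounts for the summand pⁿ m of t. It depends on t only through `m t`, so two λ
      -- with the same m carry the same scalar, not merely scalars of equal value.
      lam : ℤ → Carrier
      lam t = ι (k t) * E t

      v-lam : ∀ t → v (lam t) ≡ [ t ]
      v-lam t = ≡.trans (v-*-[] (ramified (k t) (m t) (v-k t)) (v-E t)) (cong [_] (decompose t))

      mon-wordOf-cong : ∀ {f} w → (∀ i → f i ≡ occurrences i w) → mon (wordOf f) A.≈ mon w
      mon-wordOf-cong {f} w eq = mon-cong (wordOf f) w λ i → ≡.trans (occurrences-wordOf f i) (eq i)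

      -- On congruent arguments the exponents agree, hence so does `E`, and the ratio is that of the
      -- scalars.
      lam-ratio : ∀ t₁ t₂ → t₁ ≡ t₂ [mod p ^ n ] → ∃ λ c → (lam t₁ * lam t₂ ⁻¹) ≈ ι c
      lam-ratio t₁ t₂ (divides q eq) = c , (begin
        lam t₁ * lam t₂ ⁻¹            ≈⟨ *-congʳ lam₁≈ ⟩
        ι c * lam t₂ * lam t₂ ⁻¹      ≈⟨ *-assoc (ι c) (lam t₂) (lam t₂ ⁻¹) ⟩
        ι c * (lam t₂ * lam t₂ ⁻¹)    ≈⟨ *-congˡ (⁻¹-inverse (lam t₂) (v≡[]⇒≉0 (v-lam t₂))) ⟩
        ι c * 1#                      ≈⟨ *-identityʳ (ι c) ⟩
        ι c                           ∎)
        where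
        open SetoidReasoning setoid
        k₁ = k t₁
        k₂ = k t₂
        c = k₁ K.* k₂ K.⁻¹
        ring₁ : ∀ r t u → (r ℤ.- t) ℤ.- (r ℤ.- u) ≡ ℤ.- (t ℤ.- u)
        ring₁ = solve-∀
        r-t₁≡r-t₂ : r ℤ.- t₁ ≡ r ℤ.- t₂ [mod p ^ n ]
        r-t₁≡r-t₂ = divides (ℤ.- q)
          (≡.trans (ring₁ r t₁ t₂) (≡.trans (cong ℤ.-_ eq) (ℤₚ.neg-distribˡ-* q N)))
        E₁≈E₂ : E t₁ ≈ E t₂
        E₁≈E₂ = *ₗ-congʳ (mon-wordOf-cong (wordOf (exponents t₂)) λ i →
          ≡.trans (dig-cong (r ℤ.- t₁) (r ℤ.- t₂) r-t₁≡r-t₂ i) (≡.sym (occurrences-wordOf (exponents t₂) i)))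
        ck₂≈k₁ : c K.* k₂ K.≈ k₁
        ck₂≈k₁ = K.trans (K.*-assoc k₁ (k₂ K.⁻¹) k₂) (K.trans (K.*-congˡ
          (K.trans (K.*-comm (k₂ K.⁻¹) k₂) (K.⁻¹-inverse k₂ (K.v≡[]⇒≉0 (v-k t₂))))) (K.*-identityʳ k₁))
        lam₁≈ : lam t₁ ≈ ι c * lam t₂
        lam₁≈ = begin
          ι k₁ * E t₁             ≈⟨ *-cong (⟦⟧-cong (K.sym ck₂≈k₁)) E₁≈E₂ ⟩
          ι (c K.* k₂) * E t₂     ≈⟨ *-congʳ (*-homo c k₂) ⟩
          ι c * ι k₂ * E t₂       ≈⟨ *-assoc (ι c) (ι k₂) (E t₂) ⟩
          ι c * lam t₂            ∎

      complement : ∀ t i → suc (exponents t i ℕ.+ dig t i) ≡ p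
      complement t = dig-complement r t dig-r (dig<p (r ℤ.- t))
        (divides (m t) (≡.trans (cong (ℤ._- (r ℤ.+ B (exponents t))) (≡.sym (decompose t)))
                                (ring₁ N (m t) (r ℤ.+ B (exponents t)))))
        where
        ring₁ : ∀ N m x → (N ℤ.* m ℤ.+ x) ℤ.- x ≡ m ℤ.* N
        ring₁ = solve-∀

      Ψ·lam : ∀ i t → Ψ i · lam t ≈ ι (k t) * (mon (i ∷ wordOf (exponents t)) · ρ)
      Ψ·lam i t = trans (·-linearʳ (Ψ i) (k t) (E t)) (*-congˡ (sym (mon-∷ i (wordOf (exponents t)) ρ)))

      -- A digit of at least 1 leaves room for another factor Ψᵢ. The enlarged exponents are then
      -- those belonging to t + `d i`, and m is unchanged, so the unit of the scaffold can be taken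
      -- to be 1.
      Ψ·lam≈lam : ∀ i t → 1 ℕ.≤ dig t i → Ψ i · lam t ≈ lam (t ℤ.+ d i)
      Ψ·lam≈lam i t 1≤ = trans (Ψ·lam i t) (sym (*-cong
        (reflexive (cong (ι ∘ proj₁ ∘ K.v-onto) m-same))
        (*ₗ-congʳ (mon-wordOf-cong (i ∷ w) (≡.sym ∘ occ≡)))))
        where
        t′ = t ℤ.+ d i
        w = wordOf (exponents t)
        room : suc (exponents t i) ℕ.< p
        room = ℕₚ.≤-trans
          (ℕ.s≤s (ℕₚ.≤-trans (ℕₚ.≤-reflexive (ℕₚ.+-comm 1 (exponents t i)))
                              (ℕₚ.+-monoʳ-≤ (exponents t i) 1≤)))
          (ℕₚ.≤-reflexive (complement t i))
        occ<p : ∀ j → occurrences j (i ∷ w) ℕ.< p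
        occ<p j with j ≟ i
        ... | yes refl = subst (λ l → suc l ℕ.< p) (≡.sym (occurrences-wordOf (exponents t) i)) room
        ... | no  j≢i  = subst (ℕ._< p) (≡.sym (occurrences-wordOf (exponents t) j)) (dig<p (r ℤ.- t) j)
        B-occ : B (λ j → occurrences j (i ∷ w)) ≡ d i ℤ.+ B (exponents t)
        B-occ = ≡.trans (B-occurrences (i ∷ w)) (cong (λ z → d i ℤ.+ z) (wt-exponents t))
        ring₁ : ∀ d x r t → (d ℤ.+ x) ℤ.- ℤ.- (r ℤ.- (t ℤ.+ d)) ≡ x ℤ.- ℤ.- (r ℤ.- t)
        ring₁ = solve-∀
        occ≡ : ∀ j → occurrences j (i ∷ w) ≡ exponents t′ j
        occ≡ = dig-unique (r ℤ.- t′) occ<p (subst (+ (p ^ n) ∣_)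
          (≡.sym (≡.trans (cong (ℤ._- ℤ.- (r ℤ.- t′)) B-occ) (ring₁ (d i) (B (exponents t)) r t)))
          (dig-spec (r ℤ.- t)))
        B-same : B (exponents t′) ≡ d i ℤ.+ B (exponents t)
        B-same = ≡.trans (B-cong (≡.sym ∘ occ≡)) B-occ
        ring₂ : ∀ x r y d → x ℤ.+ (r ℤ.+ y) ℤ.+ d ≡ x ℤ.+ (r ℤ.+ (d ℤ.+ y))
        ring₂ = solve-∀
        Nm-same : N ℤ.* m t′ ≡ N ℤ.* m t
        Nm-same = ℤGroup.∙-cancelʳ (r ℤ.+ B (exponents t′)) _ _ (begin
          N ℤ.* m t′ ℤ.+ (r ℤ.+ B (exponents t′))       ≡⟨ decompose t′ ⟩
          t ℤ.+ d i                                     ≡⟨ cong (ℤ._+ d i) (decompose t) ⟨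
          N ℤ.* m t ℤ.+ (r ℤ.+ B (exponents t)) ℤ.+ d i ≡⟨ ring₂ (N ℤ.* m t) r (B (exponents t)) (d i) ⟩
          N ℤ.* m t ℤ.+ (r ℤ.+ (d i ℤ.+ B (exponents t))) ≡⟨ cong (λ z → N ℤ.* m t ℤ.+ (r ℤ.+ z)) B-same ⟨
          N ℤ.* m t ℤ.+ (r ℤ.+ B (exponents t′))        ∎)
          where open ≡.≡-Reasoning
        m-same : m t′ ≡ m t
        m-same = ℤₚ.*-cancelˡ-≡ N (m t′) (m t) {{ℕₚ.m^n≢0 p n}} Nm-same

      -- A zero digit means that `E t` already contains p - 1 factors Ψᵢ. Commutativity gathers them
      -- with the new one into a p-th power, which (C4) annihilates.
      Ψ·lam≈0 : ∀ i t → dig t i ≡ 0 → Ψ i · lam t ≈ 0#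
      Ψ·lam≈0 i t ≡0 = trans (Ψ·lam i t) (trans (*-congˡ vanish) (zeroʳ (ι (k t))))
        where
        f = exponents t
        rest = wordWithout i f
        full : suc (f i) ≡ p
        full = ≡.trans (cong suc (≡.sym (≡.trans (cong (f i ℕ.+_) ≡0) (ℕₚ.+-identityʳ (f i)))))
                       (complement t i)
        same : ∀ j → occurrences j (i ∷ wordOf f) ≡ occurrences j (i ∷ wordFrom i f)
        same j = ≡.trans (occurrences-∷ i j (wordOf f)) (≡.trans (cong (occurrences j (i ∷ []) ℕ.+_)
          (≡.trans (occurrences-wordOf f j) (≡.sym (occurrences-wordFrom i f j))))
          (≡.sym (occurrences-∷ i j (wordFrom i f))))
        vanish : mon (i ∷ wordOf f) · ρ ≈ 0#
        vanish = begin
          mon (i ∷ wordOf f) · ρ              ≈⟨ *ₗ-congʳ (mon-cong (i ∷ wordOf f) (i ∷ wordFrom i f) same) ⟩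
          mon (i ∷ wordFrom i f) · ρ          ≡⟨ cong (λ l → mon (replicate l i ++ rest) · ρ) full ⟩
          mon (replicate p i ++ rest) · ρ     ≈⟨ mon-replicate p i rest ρ ⟩
          (Ψ i A.^ p) · (mon rest · ρ)        ≈⟨ *ₗ-congʳ (c4 i) ⟩
          A.0# · (mon rest · ρ)               ≈⟨ *ₗ-zeroˡ (mon rest · ρ) ⟩
          0#                                  ∎
          where open SetoidReasoning setoid

      exactScaffold : IsScaffold lam Ψ ⊤⁺
      exactScaffold = record
        { 1≤𝔗      = [ 1 ] ≤⊤ᵀ
        ; isFamily = record { v-lam = v-lam ; lam-ratio = lam-ratio }
        ; Ψ·1≈0    = c1
        ; Ψ·lam-≥1 = λ i t 1≤ → K.1# , K.v-1 , equal (trans (Ψ·lam≈lam i t 1≤)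
            (sym (trans (*-congʳ 1#-homo) (*-identityˡ (lam (t ℤ.+ d i))))))
        ; Ψ·lam-≡0 = λ i t ≡0 → equal (Ψ·lam≈0 i t ≡0)
        }

theoremA1 : ∀ {c₁ ℓ₁ c₂ ℓ₂ c₃ ℓ₃ : Level} (p n : ℕ) (p-prime : Prime p)
    (K : LocalField c₁ ℓ₁ p) (L : ValuedField c₂ ℓ₂)
    (ext : TotallyRamified (LocalField.valuedField K) L (p ^ n))
    (A : KAlgebra (LocalField.valuedField K) c₃ ℓ₃)
    (dim-A : HasDimension (KAlgebra.leftModule A) (p ^ n))
    (action : LinearAction ext A)
    (b : Fin n → ℤ) (b-coprime : ∀ i → Coprime (b i) (+ p))
    (Ψ : Fin n → KAlgebra.Carrier A) →
    let module L = ValuedField L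
        open Scaffolds p n p-prime ext A action b b-coprime
    in
    (∀ (ρ : L.Carrier) (ρ≉0 : ¬ (ρ L.≈ L.0#)) → C1 Ψ → C3 Ψ → C2 Ψ ρ →
       (∀ (lam : ℤ → L.Carrier) → IsFamily lam → IsScaffold lam Ψ [ 1 ])
       × (toℕ (𝔞ᵇ (L.ord ρ ρ≉0)) ≡ p ^ n ∸ 1))
    × (∀ (ρ : L.Carrier) (ρ≉0 : ¬ (ρ L.≈ L.0#)) → C1 Ψ → C3 Ψ → C2 Ψ ρ →
       C4 Ψ → Commutative (KAlgebra._≈_ A) (KAlgebra._*_ A) →
       ∃ λ (lam : ℤ → L.Carrier) → IsScaffold lam Ψ ⊤⁺)
    × (∀ (lam : ℤ → L.Carrier) (𝔗 : ℕ ⁺) → IsScaffold lam Ψ 𝔗 →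
       C1 Ψ × C3 Ψ
       × (∀ (ρ : L.Carrier) (ρ≉0 : ¬ (ρ L.≈ L.0#)) → toℕ (𝔞ᵇ (L.ord ρ ρ≉0)) ≡ p ^ n ∸ 1 → C2 Ψ ρ))
theoremA1 p n p-prime K L ext A dim-A action b b-coprime Ψ =
    (λ ρ ρ≉0 c1 c3 c2 → scaffold ρ ρ≉0 c1 c3 c2 , 𝔞-ρ ρ ρ≉0 c1 c3 c2)
  , (λ ρ ρ≉0 c1 c3 c2 c4 comm →
      Commuting.lam ρ ρ≉0 c1 c3 c2 c4 comm , Commuting.exactScaffold ρ ρ≉0 c1 c3 c2 c4 comm)
  , (λ lam 𝔗 isScaffold → IsScaffold.Ψ·1≈0 isScaffold ,
      shifting⇒C3 (scaffold⇒shifting isScaffold) , shifting⇒C2 (scaffold⇒shifting isScaffold))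
  where
  open Theorem p n p-prime ext A action b b-coprime Ψ
  open FromShifting
  open FromValuations
  open Scaffolds p n p-prime ext A action b b-coprime
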